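{- Let $\mathbb F$ be a field. For all real $0<c<1$: if circuit complexity $\mathrm C$ is submultiplicative on $\lceil 4/c\rceil^2$-mode tensors over $\mathbb F$, then the permanents $\mathrm{per}_n=\sum_{\pi\in S_n}\prod_{i=1}^n x_{i,\pi(i)}$ of $n\times n$ matrices of indeterminates have arithmetic circuits over $\mathbb F$ of size $O(2^{cn})$.
   Context: A $d$-mode tensor over $\mathbb F$ is a polynomial in variables partitioned into $d$ nonempty disjoint sets $X_1,\dots,X_d$ (modes, of arbitrary finite sizes) all of whose monomials contain exactly one variable from each mode, with degree one. The Kronecker product $S\otimes T$ of $d$-mode tensors with modes $X_i$ and $Y_i$ is the polynomial product $ST$, viewed as a $d$-mode tensor with modes $X_i\times Y_i$ (a product $xy$ with $x\in X_i$, $y\in Y_i$ is regarded as one variable). An arithmetic circuit is a directed acyclic graph whose sources (inputs) are labeled by field elements or variables, whose other vertices (gates) are labeled $+$ or $\times$ (with arbitrary fan-in), and whose edges (wires) are labeled by field elements by which the transmitted value is multiplied; its size is the number of wires. $\mathrm C(T)$ is the minimum size of an arithmetic circuit over $\mathbb F$ computing $T$. $\mathrm C$ is submultiplicative on $d$-mode tensors if $\mathrm C(T\otimes U)\le \mathrm C(T)\cdot\mathrm C(U)$ for all $d$-mode tensors $T,U$ over $\mathbb F$. -}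

module Defs where

open import Level using (Level; _⊔_)
open import Algebra.Bundles using (CommutativeRing)
open import Algebra.Apartness.Bundles using (HeytingField)
open import Axiom.ExcludedMiddle using (ExcludedMiddle)
open import Data.Fin.Base using (Fin; zero; suc; quotient; remainder)
open import Data.Fin.Properties using (_≟_)
open import Data.Integer.Base using (+_)
open import Data.List.Base using (List; []; _∷_; [_]; foldr; filter; allFin; cartesianProductWith)
open import Data.List.NonEmpty.Base as List⁺ using (List⁺; _∷_)
open import Data.Nat.Base using (ℕ; zero; suc; _≤_; NonZero)
import Data.Nat.Base as ℕ
import Data.Nat.Properties as ℕ
open import Data.Nat.Induction using (<-wellFounded)
open import Data.Product.Base using (∃; Σ-syntax; ∃-syntax; _×_; _,_; proj₁; proj₂)
open import Data.Rational.Base using (ℚ)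
import Data.Rational.Base as ℚ
open import Data.Sum.Base using (_⊎_)
open import Data.Vec.Base using (Vec; []; _∷_; lookup; zipWith)
open import Data.Vec.Relation.Unary.All using (All; []; _∷_)
open import Data.Vec.Relation.Unary.All.Properties using (lookup⁺)
open import Data.Vec.Relation.Unary.AllPairs using (allPairs?)
open import Data.Vec.Relation.Unary.Unique.Propositional using (Unique)
open import Function.Base using (_∘_)
open import Function.Bundles using (_⇔_)
open import Induction.WellFounded using (Acc; acc)
open import Relation.Binary.PropositionalEquality using (_≡_; refl; trans)
open import Relation.Nullary using (¬_; ¬?; yes; no)
open import Relation.Unary using (Decidable)

------------------------------------------------------------------------
-- Real numbers

-- Two-sided Dedekind cuts.
record ℝ : Set₁ where
  field
    lower upper     : ℚ → Set
    lower-inhabited : ∃ lower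
    upper-inhabited : ∃ upper
    lower-rounded   : ∀ q → lower q ⇔ (∃[ r ] q ℚ.< r × lower r)
    upper-rounded   : ∀ r → upper r ⇔ (∃[ q ] q ℚ.< r × upper q)
    disjoint        : ∀ q → ¬ (lower q × upper q)
    located         : ∀ q r → q ℚ.< r → lower q ⊎ upper r

infix 4 _<ℝ_ _ℝ<_

_<ℝ_ : ℚ → ℝ → Set
q <ℝ x = ℝ.lower x q

_ℝ<_ : ℝ → ℚ → Set
x ℝ< q = ℝ.upper x q

-- a ≤ k · x, using that k · x is the infimum of k · r over rationals r > x.
_≤_·ℝ_ : ℕ → ℕ → ℝ → Set
a ≤ k ·ℝ x = ∀ r → x ℝ< r → (+ a) ℚ./ 1 ℚ.≤ ((+ k) ℚ./ 1) ℚ.* r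

-- m = ⌈ a / x ⌉ for positive a and x: m is the least k with a / x ≤ k,
-- that is, with a ≤ k · x.
_Is⌈_/_⌉ : ℕ → ℕ → ℝ → Set
m Is⌈ a / x ⌉ = a ≤ m ·ℝ x × (∀ k → a ≤ k ·ℝ x → m ≤ k)

-- s ≤ K · 2 ^ (x · n) for positive x.  The right-hand side is the infimum
-- of K · 2 ^ ((p / q) · n) over rationals p / q > x, and
-- s ≤ K · 2 ^ ((p / q) · n) is raised to the power q to stay in ℕ.
_≤_·2^[_·_] : ℕ → ℕ → ℝ → ℕ → Set
s ≤ K ·2^[ x · n ] =
  ∀ (p q : ℕ) .{{_ : NonZero q}} → x ℝ< ((+ p) ℚ./ q) →
  s ℕ.^ q ≤ K ℕ.^ q ℕ.* 2 ℕ.^ (p ℕ.* n)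

-- f n = O(2 ^ (x · n)) for positive x.
_∈O[2^_·n] : (ℕ → ℕ) → ℝ → Set
f ∈O[2^ x ·n] = ∃[ K ] ∃[ n₀ ] ∀ n → n₀ ≤ n → f n ≤ K ·2^[ x · n ]

------------------------------------------------------------------------
-- Index sets

-- Permutations of Fin n in one-line notation: an injective self-map of
-- Fin n is a bijection.
allVecs : ∀ k n → List (Vec (Fin n) k)
allVecs zero    n = [ [] ]
allVecs (suc k) n = cartesianProductWith _∷_ (allFin n) (allVecs k n)

unique? : ∀ {k n} → Decidable {A = Vec (Fin n) k} Unique
unique? = allPairs? (λ i j → ¬? (i ≟ j))

permutations : ∀ n → List (Vec (Fin n) n)
permutations n = filter unique? (allVecs n n)

-- For modes of sizes ns, an index chooses one element of each mode.
Index : ∀ {d} → Vec ℕ d → Set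
Index ns = All Fin ns

indices : ∀ {d} (ns : Vec ℕ d) → List (Index ns)
indices []       = [ [] ]
indices (n ∷ ns) = cartesianProductWith _∷_ (allFin n) (indices ns)

-- Mode i of a Kronecker product is Fin nᵢ × Fin mᵢ, coded as
-- Fin (nᵢ * mᵢ) through the standard bijection.
splitIndex : ∀ {d} (ns ms : Vec ℕ d) → Index (zipWith ℕ._*_ ns ms) → Index ns × Index ms
splitIndex []       []       []       = [] , []
splitIndex (n ∷ ns) (m ∷ ms) (k ∷ ks) =
  let is , js = splitIndex ns ms ks in
  (quotient m k ∷ is) , (remainder {n} m k ∷ js)

nonZero-* : ∀ {d} {ns ms : Vec ℕ d} → All NonZero ns → All NonZero ms →
            All NonZero (zipWith ℕ._*_ ns ms)
nonZero-* {ns = []}     {[]}     []        []        = []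
nonZero-* {ns = n ∷ ns} {m ∷ ms} (n≢0 ∷ p) (m≢0 ∷ q) =
  ℕ.m*n≢0 n m {{n≢0}} {{m≢0}} ∷ nonZero-* p q

------------------------------------------------------------------------

module OverField {c ℓ₁ ℓ₂ : Level} (F : HeytingField c ℓ₁ ℓ₂) where

  private module F = HeytingField F

  ----------------------------------------------------------------------
  -- Polynomials

  -- The polynomial ring F[V], as the free commutative F-algebra on V:
  -- expressions up to the congruence generated by the laws of commutative
  -- rings and the operations of F.  Equality is that of formal polynomials,
  -- not of polynomial functions on F.
  infixl 6 _+ₚ_
  infixl 7 _*ₚ_
  infix  4 _≈ₚ_

  data Poly (V : Set) : Set c where
    con  : F.Carrier → Poly V
    var  : V → Poly V
    _+ₚ_ : Poly V → Poly V → Poly V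
    _*ₚ_ : Poly V → Poly V → Poly V

  data _≈ₚ_ {V : Set} : Poly V → Poly V → Set (c ⊔ ℓ₁) where
    ≈-refl      : ∀ {p} → p ≈ₚ p
    ≈-sym       : ∀ {p q} → p ≈ₚ q → q ≈ₚ p
    ≈-trans     : ∀ {p q r} → p ≈ₚ q → q ≈ₚ r → p ≈ₚ r
    +-cong      : ∀ {p p′ q q′} → p ≈ₚ p′ → q ≈ₚ q′ → p +ₚ q ≈ₚ p′ +ₚ q′
    *-cong      : ∀ {p p′ q q′} → p ≈ₚ p′ → q ≈ₚ q′ → p *ₚ q ≈ₚ p′ *ₚ q′
    +-assoc     : ∀ p q r → (p +ₚ q) +ₚ r ≈ₚ p +ₚ (q +ₚ r)
    +-comm      : ∀ p q → p +ₚ q ≈ₚ q +ₚ p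
    +-identityˡ : ∀ p → con F.0# +ₚ p ≈ₚ p
    *-assoc     : ∀ p q r → (p *ₚ q) *ₚ r ≈ₚ p *ₚ (q *ₚ r)
    *-comm      : ∀ p q → p *ₚ q ≈ₚ q *ₚ p
    *-identityˡ : ∀ p → con F.1# *ₚ p ≈ₚ p
    distribˡ    : ∀ p q r → p *ₚ (q +ₚ r) ≈ₚ p *ₚ q +ₚ p *ₚ r
    zeroˡ       : ∀ p → con F.0# *ₚ p ≈ₚ con F.0#
    con-cong    : ∀ {a b} → a F.≈ b → con a ≈ₚ con b
    con-+       : ∀ a b → con (a F.+ b) ≈ₚ con a +ₚ con b
    con-*       : ∀ a b → con (a F.* b) ≈ₚ con a *ₚ con b

  -ₚ_ : ∀ {V} → Poly V → Poly V
  -ₚ p = con (F.- F.1#) *ₚ p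

  private
    distribʳ : ∀ {V} (p q r : Poly V) → (q +ₚ r) *ₚ p ≈ₚ q *ₚ p +ₚ r *ₚ p
    distribʳ p q r =
      ≈-trans (*-comm (q +ₚ r) p)
        (≈-trans (distribˡ p q r) (+-cong (*-comm p q) (*-comm p r)))

    -‿inverseˡ : ∀ {V} (p : Poly V) → (-ₚ p) +ₚ p ≈ₚ con F.0#
    -‿inverseˡ p =
      ≈-trans (+-cong ≈-refl (≈-sym (*-identityˡ p)))
        (≈-trans (≈-sym (distribʳ p _ _))
          (≈-trans (*-cong (≈-trans (≈-sym (con-+ _ _)) (con-cong (F.-‿inverseˡ F.1#))) ≈-refl)
            (zeroˡ p)))

  polyRing : Set → CommutativeRing c (c ⊔ ℓ₁)
  polyRing V = record
    { Carrier = Poly V ; _≈_ = _≈ₚ_ ; _+_ = _+ₚ_ ; _*_ = _*ₚ_ ; -_ = -ₚ_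
    ; 0# = con F.0# ; 1# = con F.1#
    ; isCommutativeRing = record
      { isRing = record
        { +-isAbelianGroup = record
          { isGroup = record
            { isMonoid = record
              { isSemigroup = record
                { isMagma = record
                  { isEquivalence = record { refl = ≈-refl ; sym = ≈-sym ; trans = ≈-trans }
                  ; ∙-cong = +-cong }
                ; assoc = +-assoc }
              ; identity = +-identityˡ , λ p → ≈-trans (+-comm _ _) (+-identityˡ p) }
            ; inverse = -‿inverseˡ , λ p → ≈-trans (+-comm _ _) (-‿inverseˡ p)
            ; ⁻¹-cong = *-cong ≈-refl }
          ; comm = +-comm }
        ; *-cong = *-cong
        ; *-assoc = *-assoc
        ; *-identity = *-identityˡ , λ p → ≈-trans (*-comm _ _) (*-identityˡ p)
        ; distrib = distribˡ , distribʳ }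
      ; *-comm = *-comm } }

  -- The universal property of F[V].
  module Evaluation {r ℓ : Level} (R : CommutativeRing r ℓ) where

    private module R = CommutativeRing R

    module _
      (φ      : F.Carrier → R.Carrier)
      (φ-cong : ∀ {a b} → a F.≈ b → φ a R.≈ φ b)
      (φ-+    : ∀ a b → φ (a F.+ b) R.≈ φ a R.+ φ b)
      (φ-*    : ∀ a b → φ (a F.* b) R.≈ φ a R.* φ b)
      (φ-0    : φ F.0# R.≈ R.0#)
      (φ-1    : φ F.1# R.≈ R.1#)
      {V : Set} (ρ : V → R.Carrier)
      where

      eval : Poly V → R.Carrier
      eval (con a)  = φ a
      eval (var v)  = ρ v
      eval (p +ₚ q) = eval p R.+ eval q
      eval (p *ₚ q) = eval p R.* eval q

      eval-cong : ∀ {p q} → p ≈ₚ q → eval p R.≈ eval q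
      eval-cong ≈-refl           = R.refl
      eval-cong (≈-sym e)        = R.sym (eval-cong e)
      eval-cong (≈-trans e f)    = R.trans (eval-cong e) (eval-cong f)
      eval-cong (+-cong e f)     = R.+-cong (eval-cong e) (eval-cong f)
      eval-cong (*-cong e f)     = R.*-cong (eval-cong e) (eval-cong f)
      eval-cong (+-assoc _ _ _)  = R.+-assoc _ _ _
      eval-cong (+-comm _ _)     = R.+-comm _ _
      eval-cong (+-identityˡ _)  = R.trans (R.+-congʳ φ-0) (R.+-identityˡ _)
      eval-cong (*-assoc _ _ _)  = R.*-assoc _ _ _
      eval-cong (*-comm _ _)     = R.*-comm _ _
      eval-cong (*-identityˡ _)  = R.trans (R.*-congʳ φ-1) (R.*-identityˡ _)
      eval-cong (distribˡ _ _ _) = R.distribˡ _ _ _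
      eval-cong (zeroˡ _)        = R.trans (R.*-congʳ φ-0) (R.trans (R.zeroˡ _) (R.sym φ-0))
      eval-cong (con-cong e)     = φ-cong e
      eval-cong (con-+ a b)      = φ-+ a b
      eval-cong (con-* a b)      = φ-* a b

  ∑ ∏ : ∀ {a} {A : Set a} {V} → List A → (A → Poly V) → Poly V
  ∑ xs f = foldr (λ x p → f x +ₚ p) (con F.0#) xs
  ∏ xs f = foldr (λ x p → f x *ₚ p) (con F.1#) xs

  syntax ∑ xs (λ x → p) = ∑[ x ∈ xs ] p
  syntax ∏ xs (λ x → p) = ∏[ x ∈ xs ] p

  per : ∀ n → Poly (Fin n × Fin n)
  per n = ∑[ π ∈ permutations n ] ∏[ i ∈ allFin n ] var (i , lookup π i)

  ----------------------------------------------------------------------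
  -- Tensors

  -- A d-mode tensor with modes Xᵢ = Fin (lookup sizes i), given by the
  -- coefficients of the monomials with exactly one variable from each mode.
  record Tensor (d : ℕ) : Set c where
    field
      sizes    : Vec ℕ d
      nonEmpty : All NonZero sizes
      coeff    : Index sizes → F.Carrier

    -- The disjoint union of the modes.
    Var : Set
    Var = Σ[ i ∈ Fin d ] Fin (lookup sizes i)

    poly : Poly Var
    poly = ∑[ is ∈ indices sizes ] (con (coeff is) *ₚ (∏[ i ∈ allFin d ] var (i , lookup⁺ is i)))

  -- The coefficient of ∏ᵢ xᵢyᵢ in S T is that of ∏ᵢ xᵢ in S times that of
  -- ∏ᵢ yᵢ in T.
  infixl 7 _⊗_

  _⊗_ : ∀ {d} → Tensor d → Tensor d → Tensor d
  S ⊗ T = record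
    { sizes    = zipWith ℕ._*_ S.sizes T.sizes
    ; nonEmpty = nonZero-* S.nonEmpty T.nonEmpty
    ; coeff    = λ ks → let is , js = splitIndex S.sizes T.sizes ks in
                        S.coeff is F.* T.coeff js
    }
    where
    module S = Tensor S
    module T = Tensor T

  ----------------------------------------------------------------------
  -- Arithmetic circuits

  -- A wire entering from one of k earlier vertices, with its label.
  Wire : ℕ → Set c
  Wire k = F.Carrier × Fin k

  -- Parallel wires are allowed: squaring is a gate with two wires from the
  -- same vertex.
  data Vertex (V : Set) (k : ℕ) : Set c where
    constant     : F.Carrier → Vertex V k
    variable′    : V → Vertex V k
    sum-gate     : List⁺ (Wire k) → Vertex V k
    product-gate : List⁺ (Wire k) → Vertex V k

  -- Directed acyclic graphs with k vertices listed in a topological order;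
  -- Fin k counts the vertices from the last one added.
  infixl 5 _▷_

  data DAG (V : Set) : ℕ → Set c where
    []  : DAG V 0
    _▷_ : ∀ {k} → DAG V k → Vertex V k → DAG V (suc k)

  transmitted : ∀ {V k} → (Fin k → Poly V) → Wire k → Poly V
  transmitted val (a , j) = con a *ₚ val j

  vertexValue : ∀ {V k} → (Fin k → Poly V) → Vertex V k → Poly V
  vertexValue val (constant a)      = con a
  vertexValue val (variable′ v)     = var v
  vertexValue val (sum-gate ws)     = ∑ (List⁺.toList ws) (transmitted val)
  vertexValue val (product-gate ws) = ∏ (List⁺.toList ws) (transmitted val)

  value : ∀ {V k} → DAG V k → Fin k → Poly V
  value (G ▷ v) zero    = vertexValue (value G) v
  value (G ▷ v) (suc j) = value G j

  fanIn : ∀ {V k} → Vertex V k → ℕ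
  fanIn (constant _)      = 0
  fanIn (variable′ _)     = 0
  fanIn (sum-gate ws)     = List⁺.length ws
  fanIn (product-gate ws) = List⁺.length ws

  wires : ∀ {V k} → DAG V k → ℕ
  wires []      = 0
  wires (G ▷ v) = wires G ℕ.+ fanIn v

  record Circuit (V : Set) : Set c where
    field
      {order} : ℕ
      graph   : DAG V order
      output  : Fin order

    size : ℕ
    size = wires graph

  _Computes_ : ∀ {V} → Circuit V → Poly V → Set (c ⊔ ℓ₁)
  A Computes p = value (Circuit.graph A) (Circuit.output A) ≈ₚ p

  HasCircuitOfSize : ∀ {V} → Poly V → ℕ → Set (c ⊔ ℓ₁)
  HasCircuitOfSize {V} p s = Σ[ A ∈ Circuit V ] A Computes p × Circuit.size A ≡ s

  IsMinimumSize : ∀ {V} → Poly V → ℕ → Set (c ⊔ ℓ₁)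
  IsMinimumSize p s = HasCircuitOfSize p s × (∀ t → HasCircuitOfSize p t → s ≤ t)

  -- This determines C.  That such a C exists needs classical logic, see
  -- circuitComplexity below.
  IsCircuitComplexity : ∀ {d} → (Tensor d → ℕ) → Set (c ⊔ ℓ₁)
  IsCircuitComplexity C = ∀ T → IsMinimumSize (Tensor.poly T) (C T)

  IsSubmultiplicative : ∀ {d} → (Tensor d → ℕ) → Set c
  IsSubmultiplicative C = ∀ T U → C (T ⊗ U) ≤ C T ℕ.* C U

  ----------------------------------------------------------------------
  -- Existence of the circuit complexity function in classical logic

  private
    record Extension {V k} (G : DAG V k) (p : Poly V) : Set (c ⊔ ℓ₁) where
      field
        {order} : ℕ
        graph   : DAG V order
        embed   : Fin k → Fin order
        same    : ∀ j → value graph (embed j) ≡ value G j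
        output  : Fin order
        correct : value graph output ≈ₚ p

    binary : ∀ {V k} {G : DAG V k} {p q r : Poly V}
             (v : ∀ {j} → Fin j → Fin j → Vertex V j) →
             (∀ {j} (val : Fin j → Poly V) (x y : Fin j) →
               val x ≈ₚ p → val y ≈ₚ q → vertexValue val (v x y) ≈ₚ r) →
             (E : Extension G p) → Extension (Extension.graph E) q → Extension G r
    binary {p = p} v ok E E′ = record
      { graph   = E′.graph ▷ v (E′.embed E.output) E′.output
      ; embed   = λ j → suc (E′.embed (E.embed j))
      ; same    = λ j → trans (E′.same (E.embed j)) (E.same j)
      ; output  = zero
      ; correct = ok (value E′.graph) (E′.embed E.output) E′.output old E′.correct
      }
      where
      module E = Extension E
      module E′ = Extension E′
      old : value E′.graph (E′.embed E.output) ≈ₚ p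
      old rewrite E′.same E.output = E.correct

    compile : ∀ {V k} (G : DAG V k) (p : Poly V) → Extension G p
    compile G (con a) = record
      { graph = G ▷ constant a ; embed = suc ; same = λ _ → refl
      ; output = zero ; correct = ≈-refl }
    compile G (var x) = record
      { graph = G ▷ variable′ x ; embed = suc ; same = λ _ → refl
      ; output = zero ; correct = ≈-refl }
    compile {V} G (p +ₚ q) =
      binary (λ x y → sum-gate ((F.1# , x) ∷ (F.1# , y) ∷ []))
        (λ val x y e f → +-cong (≈-trans (*-identityˡ _) e)
          (≈-trans (+-cong (≈-trans (*-identityˡ _) f) ≈-refl)
            (CommutativeRing.+-identityʳ (polyRing V) _)))
        E (compile (Extension.graph E) q)
      where E = compile G p
    compile {V} G (p *ₚ q) =
      binary (λ x y → product-gate ((F.1# , x) ∷ (F.1# , y) ∷ []))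
        (λ val x y e f → *-cong (≈-trans (*-identityˡ _) e)
          (≈-trans (*-cong (≈-trans (*-identityˡ _) f) ≈-refl)
            (CommutativeRing.*-identityʳ (polyRing V) _)))
        E (compile (Extension.graph E) q)
      where E = compile G p

    minimum : ∀ {V} {p : Poly V} → ExcludedMiddle (c ⊔ ℓ₁) →
              ∀ {s} → Acc ℕ._<_ s → HasCircuitOfSize p s → ∃ (IsMinimumSize p)
    minimum {V} {p} em {s} (acc rec) A with em {∃[ t ] t ℕ.< s × HasCircuitOfSize p t}
    ... | yes (t , t<s , B) = minimum em (rec t<s) B
    ... | no  none          = s , A , λ t B → ℕ.≮⇒≥ (λ t<s → none (t , t<s , B))

  circuitComplexity : ExcludedMiddle (c ⊔ ℓ₁) →
                      ∀ {d} → Σ[ C ∈ (Tensor d → ℕ) ] IsCircuitComplexity C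
  circuitComplexity em = proj₁ ∘ least , proj₂ ∘ least
    where
    least : ∀ T → ∃ (IsMinimumSize (Tensor.poly T))
    least T = minimum em (<-wellFounded _)
      (record { graph = E.graph ; output = E.output } , E.correct , refl)
      where module E = Extension (compile [] (Tensor.poly T))

open OverField public

{-# OPTIONS --safe #-}

-- Let Sₖ(R) = R[z₁, …, zₖ] / (z₁², …, zₖ²).  Permanents are top coefficients:
-- per X is the coefficient of z₁ ⋯ zₙ in ∏ᵢ ∑ⱼ xᵢⱼ zⱼ, and for a matrix L the
-- coefficient of y₁ ⋯ y_b in ∏ⱼ exp(Lⱼ), where exp(Lⱼ) = ∏ₜ (1 + Lₜⱼ yₜ), is
-- ∏ₜ ∑ⱼ Lₜⱼ.  Cut X, padded by an identity block, into m × m blocks of side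
-- b = ⌊n / m⌋ + 1.  Combining the two identities,
--     per X = ∑ ∏_{(i , j)} per X_{ij}[A_{ij}, B_{ij}]
-- over the families of subsets of [b] such that every row (A_{i1}, …, A_{im})
-- and every column (B_{1j}, …, B_{mj}) partitions [b].  The right-hand side is
-- the Kronecker product of two m²-mode tensors with modes of size 2 ^ b, one
-- for the rows and one for the columns, evaluated at the permanents of all
-- submatrices of the blocks.  Each of the two tensors is a product of m top
-- coefficients of products in S_b, hence has complexity O(4 ^ b), so by
-- submultiplicativity their Kronecker product has complexity O(16 ^ b).  The
-- permanents of the submatrices are the coefficients of exp over S_b, and cost
-- O(8 ^ b).  Finally 16 ^ b = O(2 ^ (4 n / m)) = O(2 ^ (c n)).
module Submission where

open import Defs hiding
  ( +-comm; +-assoc; *-comm; *-assoc; *-identityˡ; +-identityˡ; distribˡ; zeroˡ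
  ; +-cong; *-cong )
open import Level using (Level; _⊔_)
open import Algebra.Apartness.Bundles using (HeytingField; HeytingCommutativeRing)
open import Algebra.Bundles using (CommutativeMonoid; CommutativeRing)
import Algebra.Module.Construct.Idealization as Idealization
import Algebra.Module.Construct.TensorUnit as TensorUnit
import Algebra.Properties.CommutativeMonoid.Sum
import Algebra.Properties.Semiring.Sum
open import Data.Fin.Base using (Fin; zero; suc; _↑ˡ_; _↑ʳ_; combine; remQuot; quotient; remainder; punchOut; splitAt)
open import Data.Fin.Permutation using (Permutation; permutation)
open import Data.Fin.Properties using (any?; _≟_; injective⇒≤; punchOut-injective; remQuot-combine; splitAt-↑ˡ; splitAt-↑ʳ)
open import Data.Integer.Base using (+_)
import Data.Integer.Base as ℤ
import Data.Integer.Properties as ℤ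
open import Data.List.Base using (List; []; _∷_; _++_; map; foldr; filter; tabulate; allFin; cartesianProductWith)
open import Data.List.NonEmpty.Base using (_∷_)
open import Data.List.Properties using (length-map)
open import Data.Nat.Base as ℕ using (ℕ; zero; suc; _^_; _≤_; z≤n; s≤s; NonZero)
open import Data.Nat.DivMod using (m/n*n≤m; m≡m%n+[m/n]*n; m%n<n)
import Data.Nat.Properties as ℕ
open import Data.Nat.Solver using (module +-*-Solver)
open import Data.Product.Base using (∃; ∃-syntax; _×_; _,_; proj₁; proj₂)
open import Data.Rational.Base using (0ℚ; 1ℚ; toℚᵘ)
import Data.Rational.Base as ℚ
import Data.Rational.Properties as ℚ
open import Data.Rational.Unnormalised.Base using (mkℚᵘ)
import Data.Rational.Unnormalised.Base as ℚᵘ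
import Data.Rational.Unnormalised.Properties as ℚᵘ
open import Data.Sum.Base using (_⊎_; inj₁; inj₂)
open import Data.Vec.Base using (Vec; []; _∷_; lookup; replicate; zipWith)
open import Data.Vec.Properties using (lookup-replicate)
open import Data.Vec.Relation.Unary.All using ([]; _∷_)
open import Data.Vec.Relation.Unary.All.Properties using (lookup⁺; lookup⁻)
open import Data.Vec.Relation.Unary.AllPairs using ([]; _∷_)
open import Data.Vec.Relation.Unary.Unique.Propositional using (Unique)
open import Data.Vec.Relation.Unary.Unique.Propositional.Properties using (lookup-injective)
open import Function.Base using (_∘_; id; flip)
open import Relation.Binary.PropositionalEquality as ≡ using (_≡_; _≢_)
import Relation.Binary.Reasoning.Setoid
open import Relation.Nullary using (¬_; yes; no; contradiction)
open import Relation.Unary using (Decidable)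

open +-*-Solver using (solve; _:=_; _:+_; _:*_) renaming (con to lit)

private
  variable
    a ℓ r ℓr s ℓs t ℓt : Level

-- Sums, homomorphisms and functionals

-- Working over a commutative monoid lets `Sums` and `Products` share these lemmas, for the additive
-- and the multiplicative monoid of a ring.
module FiniteSums (M : CommutativeMonoid a ℓ) where

  open CommutativeMonoid M
  open Algebra.Properties.CommutativeMonoid.Sum M public
  open Relation.Binary.Reasoning.Setoid setoid

  -- The fold has the shape of `∑` and `∏`, so `per` and `Tensor.poly` unfold to instances of it.
  sumₗ : ∀ {b} {B : Set b} → List B → (B → Carrier) → Carrier
  sumₗ xs f = foldr (λ x y → f x ∙ y) ε xs

  module _ {b} {B : Set b} where

    sumₗ-cong : ∀ (xs : List B) {f g} → (∀ x → f x ≈ g x) → sumₗ xs f ≈ sumₗ xs g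
    sumₗ-cong []       f≈g = refl
    sumₗ-cong (x ∷ xs) f≈g = ∙-cong (f≈g x) (sumₗ-cong xs f≈g)

    sumₗ-++ : ∀ (xs ys : List B) f → sumₗ (xs ++ ys) f ≈ sumₗ xs f ∙ sumₗ ys f
    sumₗ-++ []       ys f = sym (identityˡ _)
    sumₗ-++ (x ∷ xs) ys f = trans (∙-congˡ (sumₗ-++ xs ys f)) (sym (assoc _ _ _))

    sumₗ-map : ∀ {c} {C : Set c} (g : C → B) (xs : List C) f → sumₗ (map g xs) f ≈ sumₗ xs (f ∘ g)
    sumₗ-map g []       f = refl
    sumₗ-map g (x ∷ xs) f = ∙-congˡ (sumₗ-map g xs f)

    sumₗ-cartesianProductWith :
      ∀ {c d} {C : Set c} {D : Set d} (g : C → D → B) (xs : List C) (ys : List D) f →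
      sumₗ (cartesianProductWith g xs ys) f ≈ sumₗ xs (λ x → sumₗ ys (λ y → f (g x y)))
    sumₗ-cartesianProductWith g []       ys f = refl
    sumₗ-cartesianProductWith g (x ∷ xs) ys f = trans (sumₗ-++ (map (g x) ys) _ f)
      (∙-cong (sumₗ-map (g x) ys f) (sumₗ-cartesianProductWith g xs ys f))

    sumₗ-tabulate : ∀ {n} (g : Fin n → B) f → sumₗ (tabulate g) f ≈ sum (f ∘ g)
    sumₗ-tabulate {zero}  g f = refl
    sumₗ-tabulate {suc n} g f = ∙-congˡ (sumₗ-tabulate (g ∘ suc) f)

    sumₗ-sum-comm : ∀ (xs : List B) {n} (f : B → Fin n → Carrier) →
                    sumₗ xs (λ x → sum (f x)) ≈ sum (λ i → sumₗ xs (λ x → f x i))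
    sumₗ-sum-comm []       {n} f = sym (sum-replicate-zero n)
    sumₗ-sum-comm (x ∷ xs) f = trans (∙-congˡ (sumₗ-sum-comm xs f)) (sym (∑-distrib-+ (f x) _))

  sumₗ-allFin : ∀ n f → sumₗ (allFin n) f ≈ sum f
  sumₗ-allFin n f = sumₗ-tabulate {n = n} id f

  sum-↑ : ∀ m n (f : Fin (m ℕ.+ n) → Carrier) →
          sum f ≈ sum (λ i → f (i ↑ˡ n)) ∙ sum (λ j → f (m ↑ʳ j))
  sum-↑ zero    n f = sym (identityˡ _)
  sum-↑ (suc m) n f = trans (∙-congˡ (sum-↑ m n (f ∘ suc))) (sym (assoc _ _ _))

  sum-combine : ∀ m n (f : Fin (m ℕ.* n) → Carrier) →
                sum f ≈ sum (λ i → sum (λ j → f (combine {m} i j)))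
  sum-combine zero    n f = refl
  sum-combine (suc m) n f = trans (sum-↑ n (m ℕ.* n) f) (∙-congˡ (sum-combine m n (f ∘ (n ↑ʳ_))))

module Sums (R : CommutativeRing r ℓr) where
  open CommutativeRing R
  open FiniteSums +-commutativeMonoid public
  open Algebra.Properties.Semiring.Sum semiring public using (*-distribʳ-sum)

  module _ {b} {B : Set b} where
    *-distribˡ-sumₗ : ∀ x (ys : List B) f → x * sumₗ ys f ≈ sumₗ ys (λ y → x * f y)
    *-distribˡ-sumₗ x []       f = zeroʳ x
    *-distribˡ-sumₗ x (y ∷ ys) f = trans (distribˡ _ _ _) (+-congˡ (*-distribˡ-sumₗ x ys f))

    *-distribʳ-sumₗ : ∀ x (ys : List B) f → sumₗ ys f * x ≈ sumₗ ys (λ y → f y * x)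
    *-distribʳ-sumₗ x ys f = trans (*-comm _ _) (trans (*-distribˡ-sumₗ x ys f)
      (sumₗ-cong ys (λ y → *-comm _ _)))

module Products (R : CommutativeRing r ℓr) where
  open FiniteSums (CommutativeRing.*-commutativeMonoid R) public
    using ()
    renaming ( sum to prod; sumₗ to prodₗ; sum-cong-≋ to prod-cong; sum-combine to prod-combine
             ; sum-↑ to prod-↑; sumₗ-allFin to prodₗ-allFin; ∑-distrib-+ to prod-*
             ; ∑-permute to prod-permute; sum-replicate-zero to prod-replicate-one )

record RingHom (A : CommutativeRing r ℓr) (B : CommutativeRing s ℓs) : Set (r ⊔ ℓr ⊔ s ⊔ ℓs) where
  private
    module A = CommutativeRing A
    module B = CommutativeRing B
  field
    ⟦_⟧    : A.Carrier → B.Carrier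
    ⟦⟧-cong : ∀ {x y} → x A.≈ y → ⟦ x ⟧ B.≈ ⟦ y ⟧
    +-homo : ∀ x y → ⟦ x A.+ y ⟧ B.≈ ⟦ x ⟧ B.+ ⟦ y ⟧
    *-homo : ∀ x y → ⟦ x A.* y ⟧ B.≈ ⟦ x ⟧ B.* ⟦ y ⟧
    0-homo : ⟦ A.0# ⟧ B.≈ B.0#
    1-homo : ⟦ A.1# ⟧ B.≈ B.1#

  sum-homo : ∀ {n} (f : Fin n → A.Carrier) → ⟦ Sums.sum A f ⟧ B.≈ Sums.sum B (λ i → ⟦ f i ⟧)
  sum-homo {zero}  f = 0-homo
  sum-homo {suc n} f = B.trans (+-homo _ _) (B.+-congˡ (sum-homo (f ∘ suc)))

  prod-homo : ∀ {n} (f : Fin n → A.Carrier) → ⟦ Products.prod A f ⟧ B.≈ Products.prod B (λ i → ⟦ f i ⟧)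
  prod-homo {zero}  f = 1-homo
  prod-homo {suc n} f = B.trans (*-homo _ _) (B.*-congˡ (prod-homo (f ∘ suc)))

idHom : (A : CommutativeRing r ℓr) → RingHom A A
idHom A = record { ⟦_⟧ = id ; ⟦⟧-cong = id ; +-homo = λ _ _ → refl ; *-homo = λ _ _ → refl
                 ; 0-homo = refl ; 1-homo = refl }
  where open CommutativeRing A

infixr 9 _∘ʰ_

_∘ʰ_ : {A : CommutativeRing r ℓr} {B : CommutativeRing s ℓs} {C : CommutativeRing t ℓt} →
       RingHom B C → RingHom A B → RingHom A C
_∘ʰ_ {C = C} g f = record
  { ⟦_⟧ = λ x → G.⟦ F.⟦ x ⟧ ⟧ ; ⟦⟧-cong = λ e → G.⟦⟧-cong (F.⟦⟧-cong e)
  ; +-homo = λ x y → trans (G.⟦⟧-cong (F.+-homo x y)) (G.+-homo _ _)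
  ; *-homo = λ x y → trans (G.⟦⟧-cong (F.*-homo x y)) (G.*-homo _ _)
  ; 0-homo = trans (G.⟦⟧-cong F.0-homo) G.0-homo
  ; 1-homo = trans (G.⟦⟧-cong F.1-homo) G.1-homo }
  where
  open CommutativeRing C
  module G = RingHom g
  module F = RingHom f

-- An R-algebra with an R-linear functional.
record Functional (R : CommutativeRing r ℓr) (Z : CommutativeRing s ℓs) : Set (r ⊔ ℓr ⊔ s ⊔ ℓs) where
  private
    module R = CommutativeRing R
    module Z = CommutativeRing Z
  field
    const    : RingHom R Z
    top      : Z.Carrier → R.Carrier
    top-cong : ∀ {u v} → u Z.≈ v → top u R.≈ top v
    top-+    : ∀ u v → top (u Z.+ v) R.≈ top u R.+ top v
    top-*    : ∀ x u → top (RingHom.⟦ const ⟧ x Z.* u) R.≈ x R.* top u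

  open RingHom const public using ()
    renaming ( ⟦_⟧ to κ; ⟦⟧-cong to κ-cong; +-homo to κ-+; *-homo to κ-*; 0-homo to κ-0; 1-homo to κ-1
             ; sum-homo to κ-sum; prod-homo to κ-prod)

  top-0 : top Z.0# R.≈ R.0#
  top-0 = R.trans (top-cong (Z.sym (Z.trans (Z.*-congʳ κ-0) (Z.zeroˡ Z.0#))))
            (R.trans (top-* R.0# Z.0#) (R.zeroˡ _))

  top-sumₗ : ∀ {b} {B : Set b} (xs : List B) f → top (Sums.sumₗ Z xs f) R.≈ Sums.sumₗ R xs (top ∘ f)
  top-sumₗ []       f = top-0
  top-sumₗ (x ∷ xs) f = R.trans (top-+ _ _) (R.+-congˡ (top-sumₗ xs f))

idFunctional : (R : CommutativeRing r ℓr) → Functional R R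
idFunctional R = record { const = idHom R ; top = id ; top-cong = id
                        ; top-+ = λ _ _ → refl ; top-* = λ _ _ → refl }
  where open CommutativeRing R

infixr 9 _∘ᶠ_

_∘ᶠ_ : {A : CommutativeRing r ℓr} {B : CommutativeRing s ℓs} {C : CommutativeRing t ℓt} →
       Functional B C → Functional A B → Functional A C
_∘ᶠ_ {A = A} g f = record
  { const = G.const ∘ʰ F.const ; top = F.top ∘ G.top ; top-cong = F.top-cong ∘ G.top-cong
  ; top-+ = λ u v → trans (F.top-cong (G.top-+ u v)) (F.top-+ _ _)
  ; top-* = λ x u → trans (F.top-cong (G.top-* _ u)) (F.top-* x _) }
  where
  open CommutativeRing A
  module G = Functional g
  module F = Functional f

-- The idealization of `R` by itself is the ring R[z] / (z²) of dual numbers; a pair (x , x′) stands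
-- for x + x′ z.
Dual : CommutativeRing r ℓr → CommutativeRing r ℓr
Dual R = record
  { isCommutativeRing = record
    { isRing = Idealization.isRingᴺ R.ring TensorUnit.bimodule
    ; *-comm = λ { (x , x′) (y , y′) → R.*-comm x y ,
        R.trans (R.+-comm _ _) (R.+-cong (R.*-comm _ _) (R.*-comm _ _)) } } }
  where module R = CommutativeRing R

module _ (R : CommutativeRing r ℓr) where
  open CommutativeRing R

  dual : Functional R (Dual R)
  dual = record
    { const = record
      { ⟦_⟧ = _, 0#
      ; ⟦⟧-cong = λ e → e , refl
      ; +-homo = λ _ _ → refl , sym (+-identityˡ 0#)
      ; *-homo = λ x y → refl , sym (trans (+-cong (zeroʳ x) (zeroˡ y)) (+-identityˡ 0#))
      ; 0-homo = refl , refl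
      ; 1-homo = refl , refl }
    ; top = proj₂
    ; top-cong = proj₂
    ; top-+ = λ _ _ → refl
    ; top-* = λ x u → trans (+-congˡ (zeroˡ _)) (+-identityʳ _) }

mapᴰ : {A : CommutativeRing r ℓr} {B : CommutativeRing s ℓs} → RingHom A B → RingHom (Dual A) (Dual B)
mapᴰ {B = B} f = record
  { ⟦_⟧ = λ (x , x′) → ⟦ x ⟧ , ⟦ x′ ⟧
  ; ⟦⟧-cong = λ (e , e′) → ⟦⟧-cong e , ⟦⟧-cong e′
  ; +-homo = λ _ _ → +-homo _ _ , +-homo _ _
  ; *-homo = λ _ _ → *-homo _ _ , trans (+-homo _ _) (+-cong (*-homo _ _) (*-homo _ _))
  ; 0-homo = 0-homo , 0-homo
  ; 1-homo = 1-homo , 0-homo }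
  where
  open CommutativeRing B using (trans; +-cong)
  open RingHom f

-- Square-free polynomials

-- R[z₁, …, zₖ] / (z₁², …, zₖ²).
SquareFree : ℕ → CommutativeRing r ℓr → CommutativeRing r ℓr
SquareFree zero    R = R
SquareFree (suc k) R = Dual (SquareFree k R)

-- The functional takes the coefficient of z₁ ⋯ zₖ.
squareFree : ∀ k (R : CommutativeRing r ℓr) → Functional R (SquareFree k R)
squareFree zero    R = idFunctional R
squareFree (suc k) R = dual (SquareFree k R) ∘ᶠ squareFree k R

mapˢ : ∀ k {A : CommutativeRing r ℓr} {B : CommutativeRing s ℓs} → RingHom A B →
       RingHom (SquareFree k A) (SquareFree k B)
mapˢ zero    f = f
mapˢ (suc k) f = mapᴰ (mapˢ k f)

module SquareFreeElements (k : ℕ) (R : CommutativeRing r ℓr) where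
  open CommutativeRing (SquareFree k R) public hiding (zero)
  open Functional (squareFree k R) public
  open Sums (SquareFree k R) public using (sum; sum-cong-≋; sum-combine)
  open Products (SquareFree k R) public using (prod; prod-cong)

module _ {A : CommutativeRing r ℓr} {B : CommutativeRing s ℓs} (f : RingHom A B) where
  private
    module B = CommutativeRing B
    module Sᴬ k = SquareFreeElements k A
    module Sᴮ k = SquareFreeElements k B
    open RingHom f

  mapˢ-κ : ∀ k x → Sᴮ._≈_ k (RingHom.⟦_⟧ (mapˢ k f) (Sᴬ.κ k x)) (Sᴮ.κ k ⟦ x ⟧)
  mapˢ-κ zero    x = B.refl
  mapˢ-κ (suc k) x = mapˢ-κ k x , RingHom.0-homo (mapˢ k f)

  top-mapˢ : ∀ k u → Sᴮ.top k (RingHom.⟦_⟧ (mapˢ k f) u) B.≈ ⟦ Sᴬ.top k u ⟧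
  top-mapˢ zero    u       = B.refl
  top-mapˢ (suc k) (_ , u) = top-mapˢ k u

module _ (R : CommutativeRing r ℓr) where
  private
    module R where
      open CommutativeRing R public hiding (zero)
      open Sums R public
      open Products R public
    module S k = SquareFreeElements k R

  -- ∏ᵢ (1 + xᵢ zᵢ)
  exp : ∀ k → (Fin k → R.Carrier) → S.Carrier k
  exp zero    x = R.1#
  exp (suc k) x = exp k (x ∘ suc) , S._*_ k (S.κ k (x zero)) (exp k (x ∘ suc))

  exp-0 : ∀ k → S._≈_ k (exp k (λ _ → R.0#)) (S.1# k)
  exp-0 zero    = R.refl
  exp-0 (suc k) = exp-0 k , trans (*-congʳ (κ-0)) (zeroˡ _)
    where open S k

  -- In each variable, (1 + x z)(1 + y z) = 1 + (x + y) z because z² = 0.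
  exp-+ : ∀ k x y → S._≈_ k (exp k (λ i → x i R.+ y i)) (S._*_ k (exp k x) (exp k y))
  exp-+ zero    x y = R.sym (R.*-identityˡ _)
  exp-+ (suc k) x y = exp-+ k (x ∘ suc) (y ∘ suc) , (begin
    κ (x zero R.+ y zero) * exp k (λ i → x (suc i) R.+ y (suc i))
      ≈⟨ *-cong (κ-+ _ _) (exp-+ k (x ∘ suc) (y ∘ suc)) ⟩
    (κ (x zero) + κ (y zero)) * (X * Y)               ≈⟨ distribʳ _ _ _ ⟩
    κ (x zero) * (X * Y) + κ (y zero) * (X * Y)       ≈⟨ +-comm _ _ ⟩
    κ (y zero) * (X * Y) + κ (x zero) * (X * Y)
      ≈⟨ +-cong (trans (sym (*-assoc _ _ _)) (trans (*-congʳ (*-comm _ _)) (*-assoc _ _ _))) (sym (*-assoc _ _ _)) ⟩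
    X * (κ (y zero) * Y) + κ (x zero) * X * Y         ∎)
    where
    open S k
    open Relation.Binary.Reasoning.Setoid setoid
    X = exp k (x ∘ suc)
    Y = exp k (y ∘ suc)

  -- This links products of exponentials to products of sums: by `top-exp`, the top coefficient of
  -- the left-hand side is ∏ᵢ ∑ⱼ xⱼᵢ.
  exp-sum : ∀ k {n} (x : Fin n → Fin k → R.Carrier) →
            S._≈_ k (exp k (λ i → R.sum (λ j → x j i))) (S.prod k (λ j → exp k (x j)))
  exp-sum k {zero}  x = exp-0 k
  exp-sum k {suc n} x = trans (exp-+ k (x zero) _) (*-congˡ (exp-sum k (x ∘ suc)))
    where open S k

  top-exp : ∀ k x → S.top k (exp k x) R.≈ R.prod x
  top-exp zero    x = R.refl
  top-exp (suc k) x = R.trans (S.top-* k (x zero) _) (R.*-congˡ (top-exp k (x ∘ suc)))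

  gen : ∀ k → Fin k → S.Carrier k
  gen (suc k) zero    = S.0# k , S.1# k
  gen (suc k) (suc i) = gen k i , S.0# k

  gen²≈0 : ∀ k i → S._≈_ k (S._*_ k (gen k i) (gen k i)) (S.0# k)
  gen²≈0 (suc k) zero    = zeroˡ _ , trans (+-cong (zeroˡ _) (zeroʳ _)) (+-identityˡ _)
    where open S k
  gen²≈0 (suc k) (suc i) = gen²≈0 k i , trans (+-cong (zeroʳ _) (zeroˡ _)) (+-identityˡ _)
    where open S k

  top-prod-gen : ∀ k → S.top k (S.prod k (gen k)) R.≈ R.1#
  top-prod-gen zero    = R.refl
  -- The other generators are constants for the outermost `Dual`, and multiplying their product by
  -- z₁ moves it to the coefficient of z₁.
  top-prod-gen (suc k) = R.trans (S.top-cong k (trans (+-cong (zeroˡ _) (trans (*-identityˡ _)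
      (trans (proj₁ (S.sym (suc k) (Functional.κ-prod (dual (SquareFree k R)) (gen k)))) refl)))
      (+-identityˡ _))) (top-prod-gen k)
    where open S k

  -- Coefficients with respect to the monomials, which are indexed by Fin (2 ^ k).
  place : ∀ k → Fin 2 → S.Carrier k → S.Carrier (suc k)
  place k zero       u = u , S.0# k
  place k (suc zero) u = S.0# k , u

  part : ∀ k → S.Carrier (suc k) → Fin 2 → S.Carrier k
  part k u zero       = proj₁ u
  part k u (suc zero) = proj₂ u

  -- The binary digits of the index, leading digit first, tell which of z₁, ..., zₖ divide the
  -- monomial, so `Fin (2 ^ k)` encodes the subsets of the variables.
  monomial : ∀ k → Fin (2 ^ k) → S.Carrier k
  monomial zero    _ = R.1#
  monomial (suc k) a = let p = remQuot {2} (2 ^ k) a in place k (proj₁ p) (monomial k (proj₂ p))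

  polynomial : ∀ k → (Fin (2 ^ k) → R.Carrier) → S.Carrier k
  polynomial zero    h = h zero
  polynomial (suc k) h = polynomial k (h ∘ combine {2} zero) , polynomial k (h ∘ combine {2} (suc zero))

  coefficient : ∀ k → S.Carrier k → Fin (2 ^ k) → R.Carrier
  coefficient zero    u _ = u
  coefficient (suc k) u a = let p = remQuot {2} (2 ^ k) a in coefficient k (part k u (proj₁ p)) (proj₂ p)

  polynomial-cong : ∀ k {h h′} → (∀ a → h a R.≈ h′ a) → S._≈_ k (polynomial k h) (polynomial k h′)
  polynomial-cong zero    e = e zero
  polynomial-cong (suc k) e = polynomial-cong k (λ _ → e _) , polynomial-cong k (λ _ → e _)

  polynomial-coefficient : ∀ k u → S._≈_ k (polynomial k (coefficient k u)) u
  polynomial-coefficient zero    u = R.refl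
  polynomial-coefficient (suc k) u = half zero , half (suc zero)
    where
    open S k
    half : ∀ i → polynomial k (coefficient (suc k) u ∘ combine {2} i) ≈ part k u i
    half i = trans
      (polynomial-cong k (λ a → R.reflexive
        (≡.cong (λ p → coefficient k (part k u (proj₁ p)) (proj₂ p)) (remQuot-combine {2} i a))))
      (polynomial-coefficient k (part k u i))

  -- The recursion behind `polynomial` splits the index by its leading digit. Accordingly the sum
  -- falls into the terms without z₁ and the terms with z₁, which `place` puts into the two
  -- components.
  polynomial-sum : ∀ k h → S._≈_ k (polynomial k h) (S.sum k (λ a → S._*_ k (S.κ k (h a)) (monomial k a)))
  polynomial-sum zero    h = R.sym (R.trans (R.+-identityʳ _) (R.*-identityʳ _))
  polynomial-sum (suc k) h = S⁺.sym (begin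
    S⁺.sum (λ a → S⁺.κ (h a) S⁺.* monomial (suc k) a)
      ≈⟨ S⁺.sum-combine 2 (2 ^ k) _ ⟩
    S⁺.sum {2} (λ i → S⁺.sum {2 ^ k} (λ a → S⁺.κ (h (combine i a)) S⁺.* monomial (suc k) (combine {2} i a)))
      ≈⟨ S⁺.sum-cong-≋ {2} (λ i → S⁺.trans (S⁺.sum-cong-≋ {2 ^ k} (term i)) (placed i {2 ^ k} (λ a → κ (h (combine i a)) * monomial k a))) ⟩
    S⁺.sum {2} (λ i → place k i (sum (λ a → κ (h (combine i a)) * monomial k a)))
      ≈⟨ S⁺.sum-cong-≋ {2} (λ i → place-cong i (sym (polynomial-sum k (h ∘ combine i)))) ⟩
    S⁺.sum {2} (λ i → place k i (polynomial k (h ∘ combine i)))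
      ≈⟨ trans (+-congˡ (+-identityˡ _)) (+-identityʳ _) , trans (+-identityˡ _) (+-identityʳ _) ⟩
    polynomial (suc k) h ∎)
    where
    open S k
    module S⁺ = S (suc k)
    open Relation.Binary.Reasoning.Setoid S⁺.setoid
    place-cong : ∀ i {u v} → u ≈ v → place k i u S⁺.≈ place k i v
    place-cong zero       e = e , refl
    place-cong (suc zero) e = refl , e
    κ-place : ∀ i x u → S⁺.κ x S⁺.* place k i u S⁺.≈ place k i (κ x * u)
    κ-place zero       x u = refl , trans (+-cong (zeroʳ _) (zeroˡ _)) (+-identityˡ _)
    κ-place (suc zero) x u = zeroʳ _ , trans (+-congˡ (zeroˡ _)) (+-identityʳ _)
    term : ∀ i a → S⁺.κ (h (combine i a)) S⁺.* monomial (suc k) (combine {2} i a)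
                   S⁺.≈ place k i (κ (h (combine i a)) * monomial k a)
    term i a = S⁺.trans
      (S⁺.*-congˡ (S⁺.reflexive (≡.cong (λ p → place k (proj₁ p) (monomial k (proj₂ p))) (remQuot-combine {2} i a))))
      (κ-place i _ _)
    placed : ∀ i {n} (f : Fin n → Carrier) → S⁺.sum (λ a → place k i (f a)) S⁺.≈ place k i (sum f)
    placed zero       {zero}  f = S⁺.refl
    placed (suc zero) {zero}  f = S⁺.refl
    placed zero       {suc n} f = S⁺.trans (S⁺.+-congˡ (placed zero (f ∘ suc))) (refl , +-identityˡ _)
    placed (suc zero) {suc n} f = S⁺.trans (S⁺.+-congˡ (placed (suc zero) (f ∘ suc))) (+-identityˡ _ , refl)

module _ {A : CommutativeRing r ℓr} {B : CommutativeRing s ℓs} (f : RingHom A B) where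
  private
    module B = CommutativeRing B
    module Sᴮ k = SquareFreeElements k B
    open module F k = RingHom (mapˢ k f) using () renaming (⟦_⟧ to lift)
    open RingHom f

  mapˢ-exp : ∀ k x → Sᴮ._≈_ k (lift k (exp A k x)) (exp B k (⟦_⟧ ∘ x))
  mapˢ-exp zero    x = 1-homo
  mapˢ-exp (suc k) x = mapˢ-exp k (x ∘ suc) ,
    trans (F.*-homo k _ _) (*-cong (mapˢ-κ f k (x zero)) (mapˢ-exp k (x ∘ suc)))
    where open Sᴮ k

  mapˢ-monomial : ∀ k a → Sᴮ._≈_ k (lift k (monomial A k a)) (monomial B k a)
  mapˢ-monomial zero    a = 1-homo
  mapˢ-monomial (suc k) a = placed (proj₁ (remQuot {2} (2 ^ k) a)) (mapˢ-monomial k _)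
    where
    placed : ∀ i {u v} → Sᴮ._≈_ k (lift k u) v → Sᴮ._≈_ (suc k) (lift (suc k) (place A k i u)) (place B k i v)
    placed zero       e = e , F.0-homo k
    placed (suc zero) e = F.0-homo k , e

  mapˢ-polynomial : ∀ k h → Sᴮ._≈_ k (lift k (polynomial A k h)) (polynomial B k (⟦_⟧ ∘ h))
  mapˢ-polynomial zero    h = B.refl
  mapˢ-polynomial (suc k) h = mapˢ-polynomial k _ , mapˢ-polynomial k _

-- Products of sums expanded over multi-indices

module _ (R : CommutativeRing r ℓr) where
  open CommutativeRing R hiding (zero)
  open Sums R
  open Products R
  open Relation.Binary.Reasoning.Setoid setoid

  prod-sum-indices : ∀ {d} (ns : Vec ℕ d) (g : ∀ e → Fin (lookup ns e) → Carrier) →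
    prod (λ e → sum (g e)) ≈ sumₗ (indices ns) (λ is → prod (λ e → g e (lookup⁺ is e)))
  prod-sum-indices []       g = sym (+-identityʳ _)
  prod-sum-indices (n ∷ ns) g = begin
    sum (g zero) * prod (λ e → sum (g (suc e)))
      ≈⟨ *-congˡ (prod-sum-indices ns (g ∘ suc)) ⟩
    sum (g zero) * sumₗ (indices ns) G
      ≈⟨ *-distribʳ-sum _ (g zero) ⟩
    sum (λ i → g zero i * sumₗ (indices ns) G)
      ≈⟨ sum-cong-≋ (λ i → *-distribˡ-sumₗ (g zero i) (indices ns) G) ⟩
    sum (λ i → sumₗ (indices ns) (λ is → g zero i * G is))
      ≈⟨ sumₗ-allFin n _ ⟨
    sumₗ (allFin n) (λ i → sumₗ (indices ns) (λ is → g zero i * G is))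
      ≈⟨ sumₗ-cartesianProductWith _∷_ (allFin n) (indices ns) _ ⟨
    sumₗ (indices (n ∷ ns)) (λ is → prod (λ e → g e (lookup⁺ is e))) ∎
    where
    G : Index ns → Carrier
    G is = prod (λ e → g (suc e) (lookup⁺ is e))

  prod-sum-allVecs : ∀ k n (g : Fin k → Fin n → Carrier) →
    prod (λ i → sum (g i)) ≈ sumₗ (allVecs k n) (λ v → prod (λ i → g i (lookup v i)))
  prod-sum-allVecs zero    n g = sym (+-identityʳ _)
  prod-sum-allVecs (suc k) n g = begin
    sum (g zero) * prod (λ e → sum (g (suc e)))
      ≈⟨ *-congˡ (prod-sum-allVecs k n (g ∘ suc)) ⟩
    sum (g zero) * sumₗ (allVecs k n) G
      ≈⟨ *-distribʳ-sum _ (g zero) ⟩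
    sum (λ i → g zero i * sumₗ (allVecs k n) G)
      ≈⟨ sum-cong-≋ (λ i → *-distribˡ-sumₗ (g zero i) (allVecs k n) G) ⟩
    sum (λ i → sumₗ (allVecs k n) (λ is → g zero i * G is))
      ≈⟨ sumₗ-allFin n _ ⟨
    sumₗ (allFin n) (λ i → sumₗ (allVecs k n) (λ is → g zero i * G is))
      ≈⟨ sumₗ-cartesianProductWith _∷_ (allFin n) (allVecs k n) _ ⟨
    sumₗ (allVecs (suc k) n) (λ v → prod (λ i → g i (lookup v i))) ∎
    where
    G : Vec (Fin n) k → Carrier
    G v = prod (λ i → g (suc i) (lookup v i))

module _ (M : CommutativeMonoid a ℓ) where
  open CommutativeMonoid M
  open FiniteSums M
  open Relation.Binary.Reasoning.Setoid setoid

  -- In each mode `remQuot` turns the index of the Kronecker product into a pair (i , j); the sum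
  -- over j then moves past the sum over the remaining indices of the first tensor.
  sumₗ-splitIndex : ∀ {d} (ns ms : Vec ℕ d) (f : Index ns → Index ms → Carrier) →
    sumₗ (indices (zipWith ℕ._*_ ns ms))
         (λ ks → f (proj₁ (splitIndex ns ms ks)) (proj₂ (splitIndex ns ms ks)))
    ≈ sumₗ (indices ns) (λ is → sumₗ (indices ms) (f is))
  sumₗ-splitIndex []       []       f = sym (identityʳ _)
  sumₗ-splitIndex (n ∷ ns) (m ∷ ms) f = begin
    sumₗ (indices (n ℕ.* m ∷ nms)) (λ ks → f (proj₁ (split ks)) (proj₂ (split ks)))
      ≈⟨ sumₗ-cartesianProductWith _∷_ (allFin (n ℕ.* m)) (indices nms) _ ⟩
    sumₗ (allFin (n ℕ.* m)) (λ k → sumₗ (indices nms) (λ ks → f (proj₁ (split (k ∷ ks))) (proj₂ (split (k ∷ ks)))))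
      ≈⟨ sumₗ-cong (allFin (n ℕ.* m)) (λ k → sumₗ-splitIndex ns ms
           (λ is js → f (quotient {n} m k ∷ is) (remainder {n} m k ∷ js))) ⟩
    sumₗ (allFin (n ℕ.* m)) (λ k → G (remQuot {n} m k))
      ≈⟨ sumₗ-allFin (n ℕ.* m) _ ⟩
    sum (λ k → G (remQuot {n} m k))
      ≈⟨ sum-combine n m _ ⟩
    sum (λ i → sum (λ j → G (remQuot {n} m (combine {n} i j))))
      ≡⟨ sum-cong-≗ (λ i → sum-cong-≗ (λ j → ≡.cong G (remQuot-combine {n} i j))) ⟩
    sum (λ i → sum (λ j → G (i , j)))
      ≈⟨ sum-cong-≋ (λ i → sumₗ-sum-comm (indices ns) (λ is j → sumₗ (indices ms) (λ js → f (i ∷ is) (j ∷ js)))) ⟨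
    sum (λ i → sumₗ (indices ns) (λ is → sum (λ j → sumₗ (indices ms) (λ js → f (i ∷ is) (j ∷ js)))))
      ≈⟨ sum-cong-≋ {n} (λ i → sumₗ-cong (indices ns) (λ is → trans
           (sym (sumₗ-allFin m _)) (sym (sumₗ-cartesianProductWith _∷_ (allFin m) (indices ms) (f (i ∷ is)))))) ⟩
    sum (λ i → sumₗ (indices ns) (λ is → sumₗ (indices (m ∷ ms)) (f (i ∷ is))))
      ≈⟨ sumₗ-allFin n _ ⟨
    sumₗ (allFin n) (λ i → sumₗ (indices ns) (λ is → sumₗ (indices (m ∷ ms)) (f (i ∷ is))))
      ≈⟨ sumₗ-cartesianProductWith _∷_ (allFin n) (indices ns) _ ⟨
    sumₗ (indices (n ∷ ns)) (λ is → sumₗ (indices (m ∷ ms)) (f is)) ∎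
    where
    nms = zipWith ℕ._*_ ns ms
    split = splitIndex (n ∷ ns) (m ∷ ms)
    G : Fin n × Fin m → Carrier
    G (i , j) = sumₗ (indices ns) (λ is → sumₗ (indices ms) (λ js → f (i ∷ is) (j ∷ js)))

-- Independent families of square-zero variables

-- The tensor product over R of m copies of SquareFree b R.
Tower : ℕ → ℕ → CommutativeRing r ℓr → CommutativeRing r ℓr
Tower zero    b R = R
Tower (suc m) b R = SquareFree b (Tower m b R)

tower : ∀ m b (R : CommutativeRing r ℓr) → Functional R (Tower m b R)
tower zero    b R = idFunctional R
tower (suc m) b R = squareFree b (Tower m b R) ∘ᶠ tower m b R

module TowerElements (m b : ℕ) (R : CommutativeRing r ℓr) where
  open CommutativeRing (Tower m b R) public hiding (zero)
  open Functional (tower m b R) public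
  open Sums (Tower m b R) public
  open Products (Tower m b R) public

module _ (b : ℕ) (R : CommutativeRing r ℓr) where
  private
    module R where
      open CommutativeRing R public hiding (zero)
      open Sums R public
      open Products R public
    module S = SquareFreeElements b R
    module T m = TowerElements m b R

  -- Copy i is the i-th layer from outside. The outermost layer is entered by extending scalars to
  -- the inner tower, a deeper one through the constants of the layers around it.
  factor : ∀ {m} → Fin m → RingHom (SquareFree b R) (Tower m b R)
  factor {suc m} zero    = mapˢ b (Functional.const (tower m b R))
  factor {suc m} (suc i) = Functional.const (squareFree b (Tower m b R)) ∘ʰ factor i

  factor-κ : ∀ {m} (i : Fin m) x → T._≈_ m (RingHom.⟦_⟧ (factor i) (S.κ x)) (T.κ m x)
  factor-κ {suc m} zero    x = mapˢ-κ (Functional.const (tower m b R)) b x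
  factor-κ {suc m} (suc i) x = Functional.κ-cong (squareFree b (Tower m b R)) (factor-κ i x)

  -- Different copies involve disjoint sets of variables, so the coefficient of the product of all
  -- variables is multiplicative across copies.
  top-prod-factor : ∀ m (g : Fin m → S.Carrier) →
    T.top m (T.prod m (λ i → RingHom.⟦_⟧ (factor i) (g i))) R.≈ R.prod (λ i → S.top (g i))
  top-prod-factor zero    g = R.refl
  top-prod-factor (suc m) g = begin
    top (Sᵀ.top (lift (g zero) Sᵀ.* Sᵀ.prod (λ i → Sᵀ.κ (RingHom.⟦_⟧ (factor i) (g (suc i))))))
      -- The product of the deeper copies is a constant of the outermost layer and leaves its
      -- functional by linearity.
      ≈⟨ top-cong (Sᵀ.top-cong (Sᵀ.trans (Sᵀ.*-comm _ _)
           (Sᵀ.*-congʳ (Sᵀ.sym (Sᵀ.κ-prod (λ i → RingHom.⟦_⟧ (factor i) (g (suc i)))))))) ⟩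
    top (Sᵀ.top (Sᵀ.κ rest Sᵀ.* lift (g zero)))
      ≈⟨ top-cong (Sᵀ.top-* rest _) ⟩
    top (rest * Sᵀ.top (lift (g zero)))
      ≈⟨ top-cong (trans (*-comm _ _) (*-congʳ (top-mapˢ (Functional.const (tower m b R)) b (g zero)))) ⟩
    top (κ (S.top (g zero)) * rest)
      ≈⟨ top-* _ rest ⟩
    S.top (g zero) R.* top rest
      ≈⟨ R.*-congˡ (top-prod-factor m (g ∘ suc)) ⟩
    S.top (g zero) R.* R.prod (λ i → S.top (g (suc i))) ∎
    where
    open T m
    open Relation.Binary.Reasoning.Setoid R.setoid
    module Sᵀ = SquareFreeElements b (Tower m b R)
    lift = RingHom.⟦_⟧ (mapˢ b (Functional.const (tower m b R)))
    rest = prod (λ i → RingHom.⟦_⟧ (factor i) (g (suc i)))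

module _ (M : CommutativeMonoid a ℓ) where
  open CommutativeMonoid M
  open FiniteSums M

  sum-subst : ∀ {k n} (eq : k ≡ n) (f : Fin n → Carrier) → sum (λ i → f (≡.subst Fin eq i)) ≈ sum f
  sum-subst ≡.refl f = refl

-- Sums over families of subsets whose rows are partitions

-- An arrangement of d tensor modes, each of size 2 ^ b, into m rows of length m.
module Arrangement (m b d : ℕ) (mode : Fin m → Fin m → Fin d) where

  modeSizes : Vec ℕ d
  modeSizes = replicate d (2 ^ b)

  -- `lookup modeSizes e` equals 2 ^ b only propositionally, hence the transport.
  component : ∀ e → Fin (lookup modeSizes e) → Fin (2 ^ b)
  component e = ≡.subst Fin (lookup-replicate e (2 ^ b))

  infixl 9 _!_
  _!_ : Index modeSizes → Fin d → Fin (2 ^ b)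
  is ! e = component e (lookup⁺ is e)

  -- With each element of a mode read as a subset of Fin b, this is 1 if every
  -- row of subsets is a partition of Fin b, and 0 otherwise.
  partitioned : (R : CommutativeRing r ℓr) → Index modeSizes → CommutativeRing.Carrier R
  partitioned R is = prod (λ i → S.top (S.prod (λ j → monomial R b (is ! mode i j))))
    where
    open Products R
    module S = SquareFreeElements b R

  -- Tensor coefficients are taken in `A`, later the field, while the values put in place of the
  -- tensor variables lie in an `A`-algebra `R`, later a polynomial ring or a tower over one.
  module _ {A : CommutativeRing s ℓs} {R : CommutativeRing r ℓr} (φ : RingHom A R) where
    open RingHom φ
    open CommutativeRing R hiding (zero)
    open Sums R
    open Products R
    private
      module A where
        open CommutativeRing A public hiding (zero)
        open Products A public
      module S = SquareFreeElements b R
      module Sᴬ = SquareFreeElements b A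
      module T = TowerElements m b R
      ι : Fin m → S.Carrier → T.Carrier
      ι i = RingHom.⟦_⟧ (factor b R i)

    ⟦partitioned⟧ : ∀ is → ⟦ partitioned A is ⟧ ≈ partitioned R is
    ⟦partitioned⟧ is = trans (prod-homo (λ i → Sᴬ.top (Sᴬ.prod (mono i)))) (prod-cong (λ i → begin
        ⟦ Sᴬ.top (Sᴬ.prod (mono i)) ⟧                ≈⟨ top-mapˢ φ b _ ⟨
        S.top (RingHom.⟦_⟧ (mapˢ b φ) (Sᴬ.prod (mono i)))
          ≈⟨ S.top-cong (RingHom.prod-homo (mapˢ b φ) (mono i)) ⟩
        S.top (S.prod (λ j → RingHom.⟦_⟧ (mapˢ b φ) (mono i j)))
          ≈⟨ S.top-cong (S.prod-cong (λ j → mapˢ-monomial φ b (is ! mode i j))) ⟩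
        S.top (S.prod (λ j → monomial R b (is ! mode i j))) ∎))
      where
      open Relation.Binary.Reasoning.Setoid setoid
      mono : Fin m → Fin m → Sᴬ.Carrier
      mono i j = monomial A b (is ! mode i j)

    module _
      (row : Fin d → Fin m)
      (row-mode : ∀ i j → row (mode i j) ≡ i)
      (reorder : ∀ (f : Fin d → T.Carrier) → T.prod f T.≈ T.prod (λ i → T.prod (λ j → f (mode i j))))
      where

      -- Giving each row its own copy of the square-free ring turns a product of m top coefficients
      -- into one value of a single linear functional, through which sums can pass.
      top-prod-row : ∀ (u : Fin d → S.Carrier) →
        T.top (T.prod (λ e → ι (row e) (u e))) ≈ prod (λ i → S.top (S.prod (λ j → u (mode i j))))
      top-prod-row u = begin
        T.top (T.prod (λ e → ι (row e) (u e)))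
          ≈⟨ T.top-cong (reorder _) ⟩
        T.top (T.prod (λ i → T.prod (λ j → ι (row (mode i j)) (u (mode i j)))))
          ≈⟨ T.top-cong (T.prod-cong (λ i → T.prod-cong (λ j →
               T.reflexive (≡.cong (λ i → ι i (u (mode _ j))) (row-mode i j))))) ⟩
        T.top (T.prod (λ i → T.prod (λ j → ι i (u (mode i j)))))
          ≈⟨ T.top-cong (T.prod-cong (λ i → RingHom.prod-homo (factor b R i) (λ j → u (mode i j)))) ⟨
        T.top (T.prod (λ i → ι i (S.prod (λ j → u (mode i j)))))
          ≈⟨ top-prod-factor b R m (λ i → S.prod (λ j → u (mode i j))) ⟩
        prod (λ i → S.top (S.prod (λ j → u (mode i j)))) ∎
        where open Relation.Binary.Reasoning.Setoid setoid

      -- By `top-prod-row` the indicator is one top coefficient in the tower. Linearity moves the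
      -- values h and the sum over indices inside, where the sum factors into one sum per mode,
      -- which is the polynomial with coefficients h in its row's copy.
      sum-partitioned : ∀ (h : Fin d → Fin (2 ^ b) → Carrier) →
        sumₗ (indices modeSizes) (λ is → ⟦ partitioned A is ⟧ * prod (λ e → h e (is ! e)))
        ≈ prod (λ i → S.top (S.prod (λ j → polynomial R b (h (mode i j)))))
      sum-partitioned h = begin
        sumₗ (indices modeSizes) (λ is → ⟦ partitioned A is ⟧ * H is)
          ≈⟨ sumₗ-cong (indices modeSizes) term ⟩
        sumₗ (indices modeSizes) (λ is → T.top (T.prod (λ e → g e (is ! e))))
          ≈⟨ T.top-sumₗ (indices modeSizes) _ ⟨
        T.top (T.sumₗ (indices modeSizes) (λ is → T.prod (λ e → g e (is ! e))))
          ≈⟨ T.top-cong (prod-sum-indices (Tower m b R) modeSizes (λ e → g e ∘ component e)) ⟨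
        T.top (T.prod (λ e → T.sum (g e ∘ component e)))
          ≈⟨ T.top-cong (T.prod-cong {d} (λ e → T.trans
               (sum-subst T.+-commutativeMonoid (lookup-replicate e (2 ^ b)) (g e)) (collect e))) ⟩
        T.top (T.prod (λ e → ι (row e) (polynomial R b (h e))))
          ≈⟨ top-prod-row _ ⟩
        prod (λ i → S.top (S.prod (λ j → polynomial R b (h (mode i j))))) ∎
        where
        open Relation.Binary.Reasoning.Setoid setoid
        H : Index modeSizes → Carrier
        H is = prod (λ e → h e (is ! e))
        g : Fin d → Fin (2 ^ b) → T.Carrier
        g e a = T.κ (h e a) T.* ι (row e) (monomial R b a)
        collect : ∀ e → T.sum (g e) T.≈ ι (row e) (polynomial R b (h e))
        collect e = T.sym (T.trans (RingHom.⟦⟧-cong (factor b R (row e)) (polynomial-sum R b (h e)))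
          (T.trans (RingHom.sum-homo (factor b R (row e)) (λ a → S.κ (h e a) S.* monomial R b a)) (T.sum-cong-≋ (λ a →
            T.trans (RingHom.*-homo (factor b R (row e)) _ _) (T.*-congʳ (factor-κ b R (row e) (h e a)))))))
        term : ∀ is → ⟦ partitioned A is ⟧ * H is ≈ T.top (T.prod (λ e → g e (is ! e)))
        term is = begin
          ⟦ partitioned A is ⟧ * H is
            ≈⟨ trans (*-comm _ _) (*-congˡ (⟦partitioned⟧ is)) ⟩
          H is * partitioned R is
            ≈⟨ *-congˡ (top-prod-row (λ e → monomial R b (is ! e))) ⟨
          H is * T.top (T.prod (λ e → ι (row e) (monomial R b (is ! e))))
            ≈⟨ T.top-* (H is) _ ⟨
          T.top (T.κ (H is) T.* T.prod (λ e → ι (row e) (monomial R b (is ! e))))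
            ≈⟨ T.top-cong (T.*-congʳ (T.κ-prod (λ e → h e (is ! e)))) ⟩
          T.top (T.prod (λ e → T.κ (h e (is ! e))) T.* T.prod (λ e → ι (row e) (monomial R b (is ! e))))
            ≈⟨ T.top-cong (T.prod-* (λ e → T.κ (h e (is ! e))) _) ⟨
          T.top (T.prod (λ e → g e (is ! e))) ∎

-- Square grids of modes, read by rows and by columns

module Grid (m b : ℕ) where

  -- `m ^ 2` unfolds to m * (m * 1), hence the inner `combine` with the element of `Fin 1`.
  mode : Fin m → Fin m → Fin (m ^ 2)
  mode i j = combine i (combine j zero)

  row : Fin (m ^ 2) → Fin m
  row e = quotient {m} (m ^ 1) e

  column : Fin (m ^ 2) → Fin m
  column e = quotient {m} 1 (remainder {m} (m ^ 1) e)

  row-mode : ∀ i j → row (mode i j) ≡ i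
  row-mode i j = ≡.cong proj₁ (remQuot-combine i (combine j zero))

  column-mode : ∀ i j → column (mode i j) ≡ j
  column-mode i j = ≡.trans
    (≡.cong (quotient {m} 1 ∘ proj₂) (remQuot-combine i (combine {n = 1} j zero)))
    (≡.cong proj₁ (remQuot-combine j zero))

  module Rows    = Arrangement m b (m ^ 2) mode
  module Columns = Arrangement m b (m ^ 2) (flip mode)

  open Rows public using (modeSizes; component; _!_)

  module _ (M : CommutativeMonoid a ℓ) where
    open CommutativeMonoid M
    open FiniteSums M

    by-rows : ∀ (f : Fin (m ^ 2) → Carrier) → sum f ≈ sum (λ i → sum (λ j → f (mode i j)))
    by-rows f = trans (sum-combine m (m ^ 1) f) (sum-cong-≋ {m} (λ i →
      trans (sum-combine m 1 (f ∘ combine i)) (sum-cong-≋ {m} (λ j → identityʳ _))))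

    by-columns : ∀ (f : Fin (m ^ 2) → Carrier) → sum f ≈ sum (λ j → sum (λ i → f (mode i j)))
    by-columns f = trans (by-rows f) (∑-comm (λ i j → f (mode i j)))

  module _ {A : CommutativeRing s ℓs} {R : CommutativeRing r ℓr} (φ : RingHom A R) where
    open RingHom φ
    open CommutativeRing R hiding (zero)
    open Sums R
    open Products R
    private
      module S = SquareFreeElements b R
      module T = TowerElements m b R
      module ST = SquareFreeElements b (Tower m b R)
      module A = CommutativeRing A
      ι : Fin m → S.Carrier → T.Carrier
      ι i = RingHom.⟦_⟧ (factor b R i)
      ι̂ : Fin m → CommutativeRing.Carrier (SquareFree b (SquareFree b R)) → ST.Carrier
      ι̂ i = RingHom.⟦_⟧ (mapˢ b (factor b R i))

    -- The outer variables of `W i j` record row subsets, the inner ones column subsets. For fixed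
    -- row subsets the sum over column subsets is a top coefficient in a tower with one copy per
    -- column; the sum over row subsets is then carried out inside that tower.
    sum-rows-columns : ∀ (W : Fin m → Fin m → CommutativeRing.Carrier (SquareFree b (SquareFree b R))) →
      sumₗ (indices modeSizes) (λ is → sumₗ (indices modeSizes) (λ js →
        ⟦ Rows.partitioned A is A.* Columns.partitioned A js ⟧ *
        prod (λ e → coefficient R b (coefficient (SquareFree b R) b (W (row e) (column e)) (is ! e)) (js ! e))))
      ≈ T.top (T.prod (λ i → ST.top (ST.prod (λ j → ι̂ j (W i j)))))
    sum-rows-columns W = begin
      sumₗ I (λ is → sumₗ I (λ js → ⟦ p is A.* q js ⟧ * prod (ρ is js)))
        ≈⟨ sumₗ-cong I (λ is → trans
             (sumₗ-cong I (λ js → trans (*-congʳ (*-homo _ _)) (*-assoc _ _ _)))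
             (sym (*-distribˡ-sumₗ ⟦ p is ⟧ I (λ js → ⟦ q js ⟧ * prod (ρ is js))))) ⟩
      sumₗ I (λ is → ⟦ p is ⟧ * sumₗ I (λ js → ⟦ q js ⟧ * prod (ρ is js)))
        ≈⟨ sumₗ-cong I (λ is → *-congˡ (columns is)) ⟩
      sumₗ I (λ is → ⟦ p is ⟧ * T.top (T.prod (λ e → ι (column e) (U is e))))
        ≈⟨ sumₗ-cong I (λ is → T.top-* ⟦ p is ⟧ _) ⟨
      sumₗ I (λ is → T.top (T.κ ⟦ p is ⟧ T.* T.prod (λ e → ι (column e) (U is e))))
        ≈⟨ T.top-sumₗ I _ ⟨
      T.top (T.sumₗ I (λ is → T.κ ⟦ p is ⟧ T.* T.prod (λ e → ι (column e) (U is e))))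
        -- The rows are summed with the tower of the columns as base ring.
        ≈⟨ T.top-cong (Rows.sum-partitioned (Functional.const (tower m b R) ∘ʰ φ) row row-mode
             (by-rows (CommutativeRing.*-commutativeMonoid (Tower m b (Tower m b R))))
             (λ e a → ι (column e) (coefficient (SquareFree b R) b (W (row e) (column e)) a))) ⟩
      T.top (T.prod (λ i → ST.top (ST.prod (λ j → polynomial (Tower m b R) b (w (mode i j))))))
        ≈⟨ T.top-cong (T.prod-cong {m} (λ i → ST.top-cong (ST.prod-cong {m} (λ j → fold i j)))) ⟩
      T.top (T.prod (λ i → ST.top (ST.prod (λ j → ι̂ j (W i j))))) ∎
      where
      open Relation.Binary.Reasoning.Setoid setoid
      I = indices modeSizes
      p = Rows.partitioned A
      q = Columns.partitioned A
      U : Index modeSizes → Fin (m ^ 2) → S.Carrier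
      U is e = coefficient (SquareFree b R) b (W (row e) (column e)) (is ! e)
      ρ : Index modeSizes → Index modeSizes → Fin (m ^ 2) → Carrier
      ρ is js e = coefficient R b (U is e) (js ! e)
      w : Fin (m ^ 2) → Fin (2 ^ b) → T.Carrier
      w e a = ι (column e) (coefficient (SquareFree b R) b (W (row e) (column e)) a)
      columns : ∀ is → sumₗ I (λ js → ⟦ q js ⟧ * prod (ρ is js)) ≈ T.top (T.prod (λ e → ι (column e) (U is e)))
      columns is = begin
        sumₗ I (λ js → ⟦ q js ⟧ * prod (ρ is js))
          ≈⟨ Columns.sum-partitioned φ column (flip column-mode)
               (by-columns T.*-commutativeMonoid) (λ e → coefficient R b (U is e)) ⟩
        prod (λ j → S.top (S.prod (λ i → polynomial R b (coefficient R b (U is (mode i j))))))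
          ≈⟨ prod-cong {m} (λ j → S.top-cong (S.prod-cong {m} (λ i → polynomial-coefficient R b (U is (mode i j))))) ⟩
        prod (λ j → S.top (S.prod (λ i → U is (mode i j))))
          -- Returning to a single top coefficient keeps the expression linear for the sum over row
          -- subsets.
          ≈⟨ Columns.top-prod-row φ column (flip column-mode)
               (by-columns T.*-commutativeMonoid) (U is) ⟨
        T.top (T.prod (λ e → ι (column e) (U is e))) ∎
      fold : ∀ i j → polynomial (Tower m b R) b (w (mode i j)) ST.≈ ι̂ j (W i j)
      fold i j rewrite row-mode i j | column-mode i j = ST.trans
        (ST.sym (mapˢ-polynomial (factor b R j) b _))
        (RingHom.⟦⟧-cong (mapˢ b (factor b R j)) (polynomial-coefficient (SquareFree b R) b (W i j)))

    -- In block row i the exponentials over all j multiply to the exponential of a sum, whose top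
    -- coefficient in the outer variables is the product over t. Copy j of the tower keeps the inner
    -- variables of different block columns apart.
    top-exp-rows : ∀ (L : Fin m → Fin m → Fin b → S.Carrier) →
      T.top (T.prod (λ i → ST.top (ST.prod (λ j → ι̂ j (exp (SquareFree b R) b (L i j))))))
      ≈ T.top (T.prod (λ i → T.prod (λ t → T.sum (λ j → ι j (L i j t)))))
    top-exp-rows L = T.top-cong (T.prod-cong {m} (λ i → begin
      ST.top (ST.prod (λ j → ι̂ j (exp (SquareFree b R) b (L i j))))
        ≈⟨ ST.top-cong (ST.prod-cong {m} (λ j → mapˢ-exp (factor b R j) b (L i j))) ⟩
      ST.top (ST.prod (λ j → exp (Tower m b R) b (ι j ∘ L i j)))
        ≈⟨ ST.top-cong (exp-sum (Tower m b R) b (λ j → ι j ∘ L i j)) ⟨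
      ST.top (exp (Tower m b R) b (λ t → T.sum (λ j → ι j (L i j t))))
        ≈⟨ top-exp (Tower m b R) b _ ⟩
      T.prod (λ t → T.sum (λ j → ι j (L i j t))) ∎))
      where open Relation.Binary.Reasoning.Setoid T.setoid

-- The permanent as a top coefficient

-- Pigeonhole: if y were missed, punching it out of the codomain would inject `Fin (suc n)` into
-- `Fin n`.
injective⇒surjective : ∀ {n} {f : Fin n → Fin n} → (∀ {i j} → f i ≡ f j → i ≡ j) → ∀ y → ∃[ x ] f x ≡ y
injective⇒surjective {suc n} {f} inj y with any? (λ x → f x ≟ y)
... | yes found  = found
... | no  missed = contradiction (injective⇒≤ {f = λ x → punchOut (y≢f x)}
                     (λ {x} {x′} e → inj (punchOut-injective (y≢f x) (y≢f x′) e))) ℕ.1+n≰n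
  where
  y≢f : ∀ x → y ≢ f x
  y≢f x e = missed (x , ≡.sym e)

injective⇒permutation : ∀ {n} (f : Fin n → Fin n) → (∀ {i j} → f i ≡ f j → i ≡ j) → Permutation n n
injective⇒permutation f inj =
  permutation f (proj₁ ∘ onto) (proj₂ ∘ onto) (λ x → inj (proj₂ (onto (f x))))
  where onto = injective⇒surjective inj

module _ (M : CommutativeMonoid a ℓ) where
  open CommutativeMonoid M
  open FiniteSums M

  sumₗ-filter : ∀ {b p} {B : Set b} {P : B → Set p} (P? : Decidable P) (xs : List B) (f g : B → Carrier) →
    (∀ {x} → P x → f x ≈ g x) → (∀ {x} → ¬ P x → f x ≈ ε) →
    sumₗ xs f ≈ sumₗ (filter P? xs) g
  sumₗ-filter P? []       f g in-P out-P = refl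
  sumₗ-filter P? (x ∷ xs) f g in-P out-P with P? x
  ... | yes px = ∙-cong (in-P px) (sumₗ-filter P? xs f g in-P out-P)
  ... | no ¬px = trans (∙-congʳ (out-P ¬px)) (trans (identityˡ _) (sumₗ-filter P? xs f g in-P out-P))

module _ (R : CommutativeRing r ℓr) where
  open CommutativeRing R hiding (zero)
  open Sums R
  open Products R
  open Relation.Binary.Reasoning.Setoid setoid

  prod-unique : ∀ {n} (f : Fin n → Carrier) (v : Vec (Fin n) n) → Unique v →
                prod (λ i → f (lookup v i)) ≈ prod f
  prod-unique f v uniq =
    sym (prod-permute f (injective⇒permutation (lookup v) (lookup-injective uniq _ _)))

  *-prod-zero : ∀ {n} y (f : Fin n → Carrier) i → y * f i ≈ 0# → y * prod f ≈ 0#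
  *-prod-zero y f zero    e = trans (sym (*-assoc _ _ _)) (trans (*-congʳ e) (zeroˡ _))
  *-prod-zero y f (suc i) e = trans (*-congˡ (*-comm _ _)) (trans (sym (*-assoc _ _ _))
    (trans (*-congʳ (*-prod-zero y (f ∘ suc) i e)) (zeroˡ _)))

  prod-repeated : ∀ {n} (f : Fin n → Carrier) → (∀ i → f i * f i ≈ 0#) →
                  ∀ {k} (v : Vec (Fin n) k) → ¬ Unique v → prod (λ i → f (lookup v i)) ≈ 0#
  prod-repeated f sq []      ¬uniq = contradiction [] ¬uniq
  prod-repeated f sq (x ∷ v) ¬uniq with any? (λ i → x ≟ lookup v i)
  ... | yes (i , x≡) = *-prod-zero (f x) (λ i → f (lookup v i)) i
                         (trans (*-congˡ (reflexive (≡.cong f (≡.sym x≡)))) (sq x))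
  ... | no  x∉       = trans (*-congˡ (prod-repeated f sq v
                         (λ uniq → ¬uniq (lookup⁻ (λ i x≡ → x∉ (i , x≡)) ∷ uniq)))) (zeroʳ _)

module _ (R : CommutativeRing r ℓr) where
  private
    module R where
      open CommutativeRing R public hiding (zero)
      open Sums R public
      open Products R public
    module S k = SquareFreeElements k R

  identityMatrix : ∀ {k} → Fin k → Fin k → R.Carrier
  identityMatrix zero    zero    = R.1#
  identityMatrix zero    (suc _) = R.0#
  identityMatrix (suc _) zero    = R.0#
  identityMatrix (suc i) (suc j) = identityMatrix i j

  blockMatrix : ∀ {n k} → (Fin n → Fin n → R.Carrier) → Fin n ⊎ Fin k → Fin n ⊎ Fin k → R.Carrier
  blockMatrix X (inj₁ i) (inj₁ j) = X i j
  blockMatrix X (inj₁ _) (inj₂ _) = R.0#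
  blockMatrix X (inj₂ _) (inj₁ _) = R.0#
  blockMatrix X (inj₂ i) (inj₂ j) = identityMatrix i j

  -- The block diagonal matrix of `X` and an identity matrix has the same permanent as `X`; padding
  -- allows the side to be a multiple of m.
  padded : ∀ {N} n k → N ≡ n ℕ.+ k → (Fin n → Fin n → R.Carrier) → Fin N → Fin N → R.Carrier
  padded n k eq X i j = blockMatrix X (splitAt n (≡.subst Fin eq i)) (splitAt n (≡.subst Fin eq j))

  permanent : ∀ {n} → (Fin n → Fin n → R.Carrier) → R.Carrier
  permanent {n} X = R.sumₗ (permutations n) (λ π → R.prod (λ i → X i (lookup π i)))

  module _ {Z : CommutativeRing s ℓs} (F : Functional R Z) where
    open CommutativeRing Z hiding (zero)
    open Functional F
    open Sums Z
    open Products Z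

    sum-identityMatrix : ∀ {k} (i : Fin k) (y : Fin k → Carrier) →
                         sum (λ j → κ (identityMatrix i j) * y j) ≈ y i
    sum-identityMatrix {suc k} zero y = trans
      (+-cong (trans (*-congʳ κ-1) (*-identityˡ _))
              (trans (sum-cong-≋ {k} (λ j → trans (*-congʳ κ-0) (zeroˡ _))) (sum-replicate-zero k)))
      (+-identityʳ _)
    sum-identityMatrix (suc i) y = trans
      (+-cong (trans (*-congʳ κ-0) (zeroˡ _)) (sum-identityMatrix i (y ∘ suc)))
      (+-identityˡ _)

    -- Abstracts the square-zero variables to any ζᵢ with ζᵢ² = 0 whose full product has top 1.
    -- Expanding the product of linear forms then leaves exactly the permutations.
    permanent-top : ∀ {N} n k (eq : N ≡ n ℕ.+ k) (X : Fin n → Fin n → R.Carrier) (ζ : Fin N → Carrier) →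
      (∀ i → ζ i * ζ i ≈ 0#) → top (prod ζ) R.≈ R.1# →
      top (prod (λ i → sum (λ j → κ (padded n k eq X i j) * ζ j))) R.≈ permanent X
    permanent-top n k ≡.refl X ζ ζ² top-ζ = begin
      top (prod rows)
        ≈⟨ top-cong (prod-↑ n k rows) ⟩
      top (prod (λ i → rows (i ↑ˡ k)) * prod (λ i → rows (n ↑ʳ i)))
        -- A row of the identity block is a single ζ, and the rows of `X` have no entries in the
        -- last k columns.
        ≈⟨ top-cong (*-cong (prod-cong {n} rowˡ) (prod-cong {k} rowʳ)) ⟩
      top (prod (λ i → sum (λ j → κ (X i j) * ζˡ j)) * rest)
        ≈⟨ top-cong (*-congʳ (prod-sum-allVecs Z n n (λ i j → κ (X i j) * ζˡ j))) ⟩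
      top (sumₗ (allVecs n n) (λ v → prod (λ i → κ (X i (lookup v i)) * ζˡ (lookup v i))) * rest)
        ≈⟨ top-cong (*-distribʳ-sumₗ rest (allVecs n n) _) ⟩
      top (sumₗ (allVecs n n) (λ v → prod (λ i → κ (X i (lookup v i)) * ζˡ (lookup v i)) * rest))
        ≈⟨ top-sumₗ (allVecs n n) _ ⟩
      R.sumₗ (allVecs n n) (λ v → top (prod (λ i → κ (X i (lookup v i)) * ζˡ (lookup v i)) * rest))
        ≈⟨ R.sumₗ-cong (allVecs n n) separate ⟩
      R.sumₗ (allVecs n n) (λ v → weight v R.* top (prod (λ i → ζˡ (lookup v i)) * rest))
        -- A permutation only reorders its ζᵢ, which together with `rest` give the full product; a
        -- map with a repeated value has a factor ζᵢ² = 0.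
        ≈⟨ sumₗ-filter R.+-commutativeMonoid unique? (allVecs n n) _ weight
             (λ {v} uniq → R.trans (R.*-congˡ (R.trans (top-cong (trans
                (*-congʳ (prod-unique Z ζˡ v uniq)) (sym (prod-↑ n k ζ)))) top-ζ)) (R.*-identityʳ _))
             (λ {v} ¬uniq → R.trans (R.*-congˡ (R.trans (top-cong (trans
                (*-congʳ (prod-repeated Z ζˡ (λ i → ζ² (i ↑ˡ k)) v ¬uniq)) (zeroˡ _))) top-0)) (R.zeroʳ _)) ⟩
      permanent X ∎
      where
      open Relation.Binary.Reasoning.Setoid R.setoid
      X̂ = padded n k ≡.refl X
      rows : Fin (n ℕ.+ k) → Carrier
      rows i = sum (λ j → κ (X̂ i j) * ζ j)
      ζˡ : Fin n → Carrier
      ζˡ i = ζ (i ↑ˡ k)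
      rest = prod (λ i → ζ (n ↑ʳ i))
      weight : Vec (Fin n) n → R.Carrier
      weight v = R.prod (λ i → X i (lookup v i))
      separate : ∀ v → top (prod (λ i → κ (X i (lookup v i)) * ζˡ (lookup v i)) * rest)
                       R.≈ weight v R.* top (prod (λ i → ζˡ (lookup v i)) * rest)
      separate v = R.trans (top-cong (trans (*-congʳ (trans
          (prod-* (λ i → κ (X i (lookup v i))) (λ i → ζˡ (lookup v i)))
          (*-congʳ (sym (κ-prod (λ i → X i (lookup v i))))))) (*-assoc _ _ _)))
        (top-* (weight v) _)
      vanish : ∀ {l} (x : Fin l → R.Carrier) (y : Fin l → Carrier) → (∀ j → x j ≡ R.0#) → sum (λ j → κ (x j) * y j) ≈ 0#
      vanish {l} x y x≡0 = trans (sum-cong-≋ {l} (λ j →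
        trans (*-congʳ (trans (κ-cong (R.reflexive (x≡0 j))) κ-0)) (zeroˡ _))) (sum-replicate-zero l)
      entryˡˡ : ∀ i j → X̂ (i ↑ˡ k) (j ↑ˡ k) ≡ X i j
      entryˡˡ i j = ≡.cong₂ (blockMatrix X) (splitAt-↑ˡ n i k) (splitAt-↑ˡ n j k)
      entryˡʳ : ∀ i j → X̂ (i ↑ˡ k) (n ↑ʳ j) ≡ R.0#
      entryˡʳ i j = ≡.cong₂ (blockMatrix X) (splitAt-↑ˡ n i k) (splitAt-↑ʳ n k j)
      entryʳˡ : ∀ i j → X̂ (n ↑ʳ i) (j ↑ˡ k) ≡ R.0#
      entryʳˡ i j = ≡.cong₂ (blockMatrix X) (splitAt-↑ʳ n k i) (splitAt-↑ˡ n j k)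
      entryʳʳ : ∀ i j → X̂ (n ↑ʳ i) (n ↑ʳ j) ≡ identityMatrix i j
      entryʳʳ i j = ≡.cong₂ (blockMatrix X) (splitAt-↑ʳ n k i) (splitAt-↑ʳ n k j)
      rowˡ : ∀ i → rows (i ↑ˡ k) ≈ sum (λ j → κ (X i j) * ζˡ j)
      rowˡ i = trans (sum-↑ n k _) (trans
        (+-cong (sum-cong-≋ {n} (λ j → *-congʳ (κ-cong (R.reflexive (entryˡˡ i j)))))
                (vanish _ _ (entryˡʳ i)))
        (+-identityʳ _))
      rowʳ : ∀ i → rows (n ↑ʳ i) ≈ ζ (n ↑ʳ i)
      rowʳ i = trans (sum-↑ n k _) (trans
        (+-cong (vanish _ _ (entryʳˡ i))
                (trans (sum-cong-≋ {k} (λ j → *-congʳ (κ-cong (R.reflexive (entryʳʳ i j)))))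
                       (sum-identityMatrix i (λ j → ζ (n ↑ʳ j)))))
        (+-identityˡ _))

-- The permanent of a matrix cut into blocks

module _ (R : CommutativeRing r ℓr) where
  private
    module R = CommutativeRing R
    module S k = SquareFreeElements k R

  -- The linear form ∑ xᵢ zᵢ, written by recursion so that each coefficient is literally an xᵢ or
  -- zero and needs no gate.
  linear : ∀ k → (Fin k → R.Carrier) → S.Carrier k
  linear zero    x = R.0#
  linear (suc k) x = linear k (x ∘ suc) , S.κ k (x zero)

  linear-sum : ∀ k x → S._≈_ k (linear k x) (S.sum k (λ i → S._*_ k (S.κ k (x i)) (gen R k i)))
  linear-sum zero    x = R.refl
  linear-sum (suc k) x = S⁺.sym (S⁺.trans
    (S⁺.+-cong (zeroʳ _ , trans (+-cong (*-identityʳ _) (zeroˡ _)) (+-identityʳ _))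
      (S⁺.trans (S⁺.sum-cong-≋ {k} (λ i → S⁺.sym (D.κ-* (κ (x (suc i))) (gen R k i))))
        (S⁺.sym (D.κ-sum {k} (λ i → κ (x (suc i)) * gen R k i)))))
    (trans (+-identityˡ _) (sym (linear-sum k (x ∘ suc))) , +-identityʳ _))
    where
    open S k
    module S⁺ = S (suc k)
    module D = Functional (dual (SquareFree k R))

module TowerGenerators (m b : ℕ) (R : CommutativeRing r ℓr) where
  private
    module R where
      open CommutativeRing R public hiding (zero)
      open Products R public
    module S = SquareFreeElements b R
    ι : Fin m → RingHom (SquareFree b R) (Tower m b R)
    ι = factor b R
    module ι i = RingHom (ι i)
  open TowerElements m b R

  -- All m b variables of the tower in one list. Variable s of copy j has index `combine j s`, like
  -- column s of block column j.
  generator : Fin (m ℕ.* b) → Carrier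
  generator w = ι.⟦_⟧ (quotient {m} b w) (gen R b (remainder {m} b w))

  generator-combine : ∀ j s → generator (combine j s) ≡ ι.⟦_⟧ j (gen R b s)
  generator-combine j s = ≡.cong (λ (j , s) → ι.⟦_⟧ j (gen R b s)) (remQuot-combine {m} j s)

  generator² : ∀ w → generator w * generator w ≈ 0#
  generator² w = trans (sym (ι.*-homo _ _ _)) (trans (ι.⟦⟧-cong _ (gen²≈0 R b _)) (ι.0-homo _))

  top-prod-generator : top (prod generator) R.≈ R.1#
  top-prod-generator = begin
    top (prod generator)
      ≈⟨ top-cong (prod-combine m b generator) ⟩
    top (prod {m} (λ j → prod {b} (λ s → generator (combine j s))))
      ≈⟨ top-cong (prod-cong {m} (λ j → trans
           (prod-cong {b} (λ s → reflexive (generator-combine j s))) (sym (ι.prod-homo j (gen R b))))) ⟩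
    top (prod (λ j → ι.⟦_⟧ j (S.prod (gen R b))))
      ≈⟨ top-prod-factor b R m (λ _ → S.prod (gen R b)) ⟩
    R.prod {m} (λ _ → S.top (S.prod (gen R b)))
      ≈⟨ R.prod-cong {m} (λ _ → top-prod-gen R b) ⟩
    R.prod {m} (λ _ → R.1#)
      ≈⟨ R.prod-replicate-one m ⟩
    R.1# ∎
    where open Relation.Binary.Reasoning.Setoid R.setoid

module _ (m b n k : ℕ) (eq : m ℕ.* b ≡ n ℕ.+ k) (R : CommutativeRing r ℓr)
         (X : Fin n → Fin n → CommutativeRing.Carrier R) where
  open CommutativeRing R using (Carrier; _≈_; setoid)
  open Grid m b
  private
    module T = TowerElements m b R
    module S = SquareFreeElements b R
    module ST = SquareFreeElements b (Tower m b R)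
    ι : Fin m → RingHom (SquareFree b R) (Tower m b R)
    ι = factor b R
    module ι i = RingHom (ι i)
    X̂ = padded R n k eq X

  -- Row t of the block (i , j) as a linear form in the b variables of block column j.
  blockRow : Fin m → Fin m → Fin b → S.Carrier
  blockRow i j t = linear R b (λ s → X̂ (combine i t) (combine j s))

  -- Its coefficients are the permanents of the submatrices of the block (i , j) of X̂.
  blockPermanents : Fin m → Fin m → CommutativeRing.Carrier (SquareFree b (SquareFree b R))
  blockPermanents i j = exp (SquareFree b R) b (blockRow i j)

  -- `top-exp-rows` removes the exponentials. What remains is the product over all rows of the
  -- padded matrix of their linear forms in the tower variables, to which `permanent-top` applies.
  top-blockPermanents :
    T.top (T.prod (λ i → ST.top (ST.prod (λ j → RingHom.⟦_⟧ (mapˢ b (ι j)) (blockPermanents i j))))) ≈ permanent R X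
  top-blockPermanents = begin
    T.top (T.prod (λ i → ST.top (ST.prod (λ j → RingHom.⟦_⟧ (mapˢ b (ι j)) (blockPermanents i j)))))
      ≈⟨ top-exp-rows (idHom R) blockRow ⟩
    T.top (T.prod {m} (λ i → T.prod {b} (λ t → T.sum (λ j → ι.⟦_⟧ j (blockRow i j t)))))
      ≈⟨ T.top-cong (T.prod-cong {m} (λ i → T.prod-cong {b} (λ t → T.trans
           (T.sum-cong-≋ {m} (λ j → entries i t j))
           (T.sym (T.sum-combine m b (λ w → T.κ (X̂ (combine i t) w) T.* generator w)))))) ⟩
    T.top (T.prod {m} (λ i → T.prod {b} (λ t → T.sum (λ w → T.κ (X̂ (combine i t) w) T.* generator w))))
      ≈⟨ T.top-cong (T.prod-combine m b (λ v → T.sum (λ w → T.κ (X̂ v w) T.* generator w))) ⟨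
    T.top (T.prod (λ v → T.sum (λ w → T.κ (X̂ v w) T.* generator w)))
      ≈⟨ permanent-top R (tower m b R) n k eq X generator generator² top-prod-generator ⟩
    permanent R X ∎
    where
    open Relation.Binary.Reasoning.Setoid setoid
    open TowerGenerators m b R
    entries : ∀ i t j → ι.⟦_⟧ j (blockRow i j t) T.≈
              T.sum (λ s → T.κ (X̂ (combine i t) (combine j s)) T.* generator (combine j s))
    entries i t j = T.trans (ι.⟦⟧-cong j (linear-sum R b (λ s → X̂ (combine i t) (combine j s))))
      (T.trans (ι.sum-homo j {b} (λ s → S.κ (X̂ (combine i t) (combine j s)) S.* gen R b s))
      (T.sum-cong-≋ {b} (λ s → T.trans (ι.*-homo j _ _)
        (T.*-cong (factor-κ b R j _) (T.reflexive (≡.sym (generator-combine j s)))))))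

-- Circuits

open import Data.Nat.Base using (_+_; _*_; _∸_; _/_; _%_)

-- With `Q` meaning "computed by a given graph", this says that all 2 ^ k coefficients are computed;
-- it is nested for `SquareFree` over `SquareFree`.
Coefficients : ∀ {q} k (R : CommutativeRing r ℓr) (Q : CommutativeRing.Carrier R → Set q) →
               CommutativeRing.Carrier (SquareFree k R) → Set q
Coefficients zero    R Q u       = Q u
Coefficients (suc k) R Q (u , v) = Coefficients k R Q u × Coefficients k R Q v

module _ {q} {R : CommutativeRing r ℓr} {Q : CommutativeRing.Carrier R → Set q} where
  private
    module R = CommutativeRing R
    module S k = SquareFreeElements k R

  Coefficients-map : ∀ k {p} {P : R.Carrier → Set p} → (∀ {x} → Q x → P x) →
                     ∀ u → Coefficients k R Q u → Coefficients k R P u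
  Coefficients-map zero    f u       x       = f x
  Coefficients-map (suc k) f (u , v) (x , y) = Coefficients-map k f u x , Coefficients-map k f v y

  Coefficients-resp : (∀ {x y} → x R.≈ y → Q x → Q y) →
                      ∀ k {u v} → S._≈_ k u v → Coefficients k R Q u → Coefficients k R Q v
  Coefficients-resp resp zero    e        x       = resp e x
  Coefficients-resp resp (suc k) (e , e′) (x , y) = Coefficients-resp resp k e x , Coefficients-resp resp k e′ y

  Coefficients-0 : ∀ k → Q R.0# → Coefficients k R Q (S.0# k)
  Coefficients-0 zero    x = x
  Coefficients-0 (suc k) x = Coefficients-0 k x , Coefficients-0 k x

  Coefficients-κ : ∀ k {x} → Q R.0# → Q x → Coefficients k R Q (S.κ k x)
  Coefficients-κ zero    z x = x
  Coefficients-κ (suc k) z x = Coefficients-κ k z x , Coefficients-0 k z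

  Coefficients-1 : ∀ k → Q R.0# → Q R.1# → Coefficients k R Q (S.1# k)
  Coefficients-1 zero    z x = x
  Coefficients-1 (suc k) z x = Coefficients-1 k z x , Coefficients-0 k z

  Coefficients-linear : ∀ k {x} → Q R.0# → (∀ i → Q (x i)) → Coefficients k R Q (linear R k x)
  Coefficients-linear zero    z x = z
  Coefficients-linear (suc k) z x = Coefficients-linear k z (x ∘ suc) , Coefficients-κ k z (x zero)

  Coefficients-polynomial : ∀ k {h} → (∀ a → Q (h a)) → Coefficients k R Q (polynomial R k h)
  Coefficients-polynomial zero    x = x zero
  Coefficients-polynomial (suc k) x = Coefficients-polynomial k (λ _ → x _) , Coefficients-polynomial k (λ _ → x _)

  Coefficients-top : ∀ k u → Coefficients k R Q u → Q (S.top k u)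
  Coefficients-top zero    u       x       = x
  Coefficients-top (suc k) (_ , u) (_ , x) = Coefficients-top k u x

  Coefficients-lookup : ∀ k u → Coefficients k R Q u → ∀ a → Q (coefficient R k u a)
  Coefficients-lookup zero    u x a = x
  Coefficients-lookup (suc k) u x a = Coefficients-lookup k _ (half (proj₁ (remQuot {2} (2 ^ k) a))) _
    where
    half : ∀ i → Coefficients k R Q (part R k u i)
    half zero       = proj₁ x
    half (suc zero) = proj₂ x

module Computation {c ℓ₁ ℓ₂} (F : HeytingField c ℓ₁ ℓ₂) (V : Set) where
  private
    module F = HeytingField F
    R = polyRing F V
    module R = CommutativeRing R
    module S k = SquareFreeElements k R

  Graph : Set c
  Graph = ∃ (DAG F V)

  size : Graph → ℕ
  size (_ , G) = wires F G

  record Computed (G : Graph) (p : R.Carrier) : Set (c ⊔ ℓ₁) where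
    constructor computed
    field
      position : Fin (proj₁ G)
      correct  : value F (proj₂ G) position R.≈ p

  computed-resp : ∀ {G p q} → p R.≈ q → Computed G p → Computed G q
  computed-resp p≈q (computed j e) = computed j (R.trans e p≈q)

  infix 4 _⊑_
  -- Only the computed polynomials are compared, so no embedding of vertices has to be tracked.
  _⊑_ : Graph → Graph → Set (c ⊔ ℓ₁)
  G ⊑ H = ∀ {p} → Computed G p → Computed H p

  -- Constructions form a monad graded by the number of added wires: `_>>=_` adds the costs, and
  -- `keeps` makes all earlier results available later.
  record Extension {q} (G : Graph) (w : ℕ) (P : Graph → Set q) : Set (c ⊔ ℓ₁ ⊔ q) where
    constructor extension
    field
      graph : Graph
      cost  : size graph ≤ size G + w
      keeps : G ⊑ graph
      done  : P graph

  module _ {q} {P : Graph → Set q} where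

    return : ∀ {G} → P G → Extension G 0 P
    return {G} p = extension G (ℕ.m≤m+n _ 0) id p

    weaken : ∀ {G w w′} → w ≤ w′ → Extension G w P → Extension G w′ P
    weaken {G} w≤w′ (extension H cost keeps p) = extension H (ℕ.≤-trans cost (ℕ.+-monoʳ-≤ (size G) w≤w′)) keeps p

    infixl 1 _>>=_
    _>>=_ : ∀ {q′} {Q : Graph → Set q′} {G w w′} → Extension G w P →
            (∀ {H} → G ⊑ H → P H → Extension H w′ Q) → Extension G (w + w′) Q
    _>>=_ {G = G} {w} {w′} (extension H cost keeps p) f with f keeps p
    ... | extension K cost′ keeps′ q = extension K
      (ℕ.≤-trans cost′ (ℕ.≤-trans (ℕ.+-monoˡ-≤ w′ cost) (ℕ.≤-reflexive (ℕ.+-assoc (size G) w w′))))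
      (keeps′ ∘ keeps) q

    infixl 1 _<&>_
    _<&>_ : ∀ {q′} {Q : Graph → Set q′} {G w} → Extension G w P → (∀ {H} → G ⊑ H → P H → Q H) → Extension G w Q
    extension H cost keeps p <&> f = extension H cost keeps (f keeps p)

  -- The constructions run one after another; `mono` carries each result to the larger graphs built
  -- after it.
  forAll : ∀ {q n G w} {P : Fin n → Graph → Set q} →
           (∀ i {H K} → H ⊑ K → P i H → P i K) →
           (∀ i {H} → G ⊑ H → Extension H w (P i)) → Extension G (n * w) (λ H → ∀ i → P i H)
  forAll {n = zero}  mono f = return (λ ())
  forAll {n = suc n} mono f =
    f zero id >>= λ G⊑H p → forAll (mono ∘ suc) (λ i H⊑K → f (suc i) (H⊑K ∘ G⊑H)) <&> λ H⊑K ps →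
      λ { zero → mono zero H⊑K p ; (suc i) → ps i }

  vertex : ∀ {G p} (v : Vertex F V (proj₁ G)) → vertexValue F (value F (proj₂ G)) v R.≈ p →
           Extension G (fanIn F v) (λ H → Computed H p)
  vertex {k , G} v e = extension (suc k , G ▷ v) ℕ.≤-refl (λ (computed j e) → computed (suc j) e) (computed zero e)

  computed-* : ∀ {G p q} → Computed G p → Computed G q → Extension G 2 (λ H → Computed H (p R.* q))
  computed-* (computed i e) (computed j e′) = vertex (product-gate ((F.1# , i) ∷ (F.1# , j) ∷ []))
    (R.*-cong (R.trans (R.*-identityˡ _) e) (R.trans (R.*-identityʳ _) (R.trans (R.*-identityˡ _) e′)))

  computed-+ : ∀ {G p q} → Computed G p → Computed G q → Extension G 2 (λ H → Computed H (p R.+ q))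
  computed-+ (computed i e) (computed j e′) = vertex (sum-gate ((F.1# , i) ∷ (F.1# , j) ∷ []))
    (R.+-cong (R.trans (R.*-identityˡ _) e) (R.trans (R.+-identityʳ _) (R.trans (R.*-identityˡ _) e′)))

  -- Circuits for square-free polynomials

  ComputedS : ∀ k → Graph → S.Carrier k → Set (c ⊔ ℓ₁)
  ComputedS k G = Coefficients k R (Computed G)

  computedS-mono : ∀ k {u G H} → G ⊑ H → ComputedS k G u → ComputedS k H u
  computedS-mono k G⊑H = Coefficients-map k G⊑H _

  additionCost multiplicationCost : ℕ → ℕ
  additionCost       k = 2 * 2 ^ k
  multiplicationCost k = 2 * 4 ^ k

  computedS-+ : ∀ k {G u v} → ComputedS k G u → ComputedS k G v →
                Extension G (additionCost k) (λ H → ComputedS k H (S._+_ k u v))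
  computedS-+ zero    x y = computed-+ x y
  computedS-+ (suc k) (x , x′) (y , y′) = weaken bound (
    computedS-+ k x y >>= λ G⊑H z →
    computedS-+ k (computedS-mono k G⊑H x′) (computedS-mono k G⊑H y′) <&> λ H⊑K z′ →
    computedS-mono k H⊑K z , z′)
    where
    bound : additionCost k + additionCost k ≤ additionCost (suc k)
    bound = ℕ.≤-reflexive (solve 1 (λ x → lit 2 :* x :+ lit 2 :* x := lit 2 :* (lit 2 :* x)) ≡.refl (2 ^ k))

  -- The product (x + x′ z)(y + y′ z) = x y + (x y′ + x′ y) z takes three smaller products and one
  -- addition. Charging the addition as a fourth product gives the factor 4 per variable.
  computedS-* : ∀ k {G u v} → ComputedS k G u → ComputedS k G v →
                Extension G (multiplicationCost k) (λ H → ComputedS k H (S._*_ k u v))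
  computedS-* zero    x y = computed-* x y
  computedS-* (suc k) (x , x′) (y , y′) = weaken bound (
    computedS-* k x y >>= λ G⊑H xy →
    computedS-* k (computedS-mono k G⊑H x) (computedS-mono k G⊑H y′) >>= λ H⊑K xy′ →
    computedS-* k (computedS-mono k (H⊑K ∘ G⊑H) x′) (computedS-mono k (H⊑K ∘ G⊑H) y) >>= λ K⊑L x′y →
    computedS-+ k (computedS-mono k K⊑L xy′) x′y <&> λ L⊑M z →
    computedS-mono k (L⊑M ∘ K⊑L ∘ H⊑K) xy , z)
    where
    open ℕ.≤-Reasoning
    M = multiplicationCost k
    bound : M + (M + (M + additionCost k)) ≤ multiplicationCost (suc k)
    bound = begin
      M + (M + (M + 2 * 2 ^ k))
        ≤⟨ ℕ.+-monoʳ-≤ M (ℕ.+-monoʳ-≤ M (ℕ.+-monoʳ-≤ M (ℕ.*-monoʳ-≤ 2 (ℕ.^-monoˡ-≤ k (s≤s (s≤s z≤n)))))) ⟩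
      M + (M + (M + M))
        ≡⟨ solve 1 (λ x → let y = lit 2 :* x in y :+ (y :+ (y :+ y)) := lit 2 :* (lit 4 :* x)) ≡.refl (4 ^ k) ⟩
      multiplicationCost (suc k) ∎

  computedS-prod : ∀ k {n G} {u : Fin n → S.Carrier k} → Computed G R.0# → Computed G R.1# →
                   (∀ i → ComputedS k G (u i)) →
                   Extension G (n * multiplicationCost k) (λ H → ComputedS k H (S.prod k u))
  computedS-prod k {zero}  z o x = return (Coefficients-1 k z o)
  computedS-prod k {suc n} {u = u} z o x = weaken (ℕ.≤-reflexive (ℕ.+-comm (n * multiplicationCost k) _)) (
    computedS-prod k {u = u ∘ suc} z o (x ∘ suc) >>= λ G⊑H y →
    computedS-* k (computedS-mono k G⊑H (x zero)) y)

  module _ (b : ℕ) where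
    private
      B = SquareFree b R
      module SB k = SquareFreeElements k B

    ComputedSS : ∀ k → Graph → SB.Carrier k → Set (c ⊔ ℓ₁)
    ComputedSS k G = Coefficients k B (ComputedS b G)

    computedSS-mono : ∀ k {u G H} → G ⊑ H → ComputedSS k G u → ComputedSS k H u
    computedSS-mono k G⊑H = Coefficients-map k (computedS-mono b G⊑H) _

    computedSS-resp : ∀ k {G u v} → SB._≈_ k u v → ComputedSS k G u → ComputedSS k G v
    computedSS-resp k = Coefficients-resp (Coefficients-resp computed-resp b) k

    -- A constant multiplies each of the 2 ^ k coefficients separately, with one product in
    -- `SquareFree b R` each.
    computedSS-κ* : ∀ k {G x u} → ComputedS b G x → ComputedSS k G u →
                    Extension G (2 ^ k * multiplicationCost b) (λ H → ComputedSS k H (SB._*_ k (SB.κ k x) u))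
    computedSS-κ* zero    x y = weaken (ℕ.≤-reflexive (≡.sym (ℕ.*-identityˡ _))) (computedS-* b x y)
    computedSS-κ* (suc k) {x = x′} {u} x (y , y′) = weaken bound (
      computedSS-κ* k x y >>= λ G⊑H z →
      computedSS-κ* k (computedS-mono b G⊑H x) (computedSS-mono k G⊑H y′) <&> λ H⊑K z′ →
      computedSS-mono k H⊑K z , computedSS-resp k (sym (trans (+-congˡ (zeroˡ _)) (+-identityʳ _))) z′)
      where
      open SB k using (sym; trans; +-congˡ; zeroˡ; +-identityʳ)
      bound : 2 ^ k * multiplicationCost b + 2 ^ k * multiplicationCost b ≤ 2 ^ suc k * multiplicationCost b
      bound = ℕ.≤-reflexive (solve 2 (λ x y → x :* y :+ x :* y := (lit 2 :* x) :* y) ≡.refl (2 ^ k) (multiplicationCost b))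

    -- The exponential in the remaining variables is one half of the result and, multiplied by
    -- `x zero`, the other half. Reusing it, 2 ^ k - 1 products in `SquareFree b R` suffice.
    computedSS-exp : ∀ k {G} {x : Fin k → CommutativeRing.Carrier B} → Computed G R.0# → Computed G R.1# →
                     (∀ i → ComputedS b G (x i)) →
                     Extension G (2 ^ k * multiplicationCost b) (λ H → ComputedSS k H (exp B k x))
    computedSS-exp zero    z o x = weaken z≤n (return (Coefficients-1 b z o))
    computedSS-exp (suc k) z o x = weaken bound (
      computedSS-exp k z o (x ∘ suc) >>= λ G⊑H y →
      computedSS-κ* k (computedS-mono b G⊑H (x zero)) y <&> λ H⊑K w →
      computedSS-mono k H⊑K y , w)
      where
      bound : 2 ^ k * multiplicationCost b + 2 ^ k * multiplicationCost b ≤ 2 ^ suc k * multiplicationCost b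
      bound = ℕ.≤-reflexive (solve 2 (λ x y → x :* y :+ x :* y := (lit 2 :* x) :* y) ≡.refl (2 ^ k) (multiplicationCost b))

  constants : ∀ {G} → Extension G 0 (λ H → Computed H R.0# × Computed H R.1#)
  constants = vertex (constant F.0#) R.refl >>= λ _ z → vertex (constant F.1#) R.refl <&> λ H⊑K o → H⊑K z , o

  circuit : ∀ {w p} → Extension (0 , []) w (λ H → Computed H p) → ∃[ t ] t ≤ w × HasCircuitOfSize F p t
  circuit (extension (k , G) cost _ (computed j e)) = wires F G , cost , record { graph = G ; output = j } , e , ≡.refl

  -- Composition of circuits

  module Substitution {U : Set} (ρ : U → R.Carrier) where

    substitute : Poly F U → R.Carrier
    substitute = Evaluation.eval F R con con-cong con-+ con-* R.refl R.refl ρ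

    substitute-cong : ∀ {p q} → _≈ₚ_ F p q → substitute p R.≈ substitute q
    substitute-cong = Evaluation.eval-cong F R con con-cong con-+ con-* R.refl R.refl ρ

    module _ {l} (H : DAG F U l) (K : Graph) (ys : ∀ j → Computed K (substitute (value F H j))) where

      rewire : Wire F l → Wire F (proj₁ K)
      rewire (a , j) = a , Computed.position (ys j)

      sum-rewire : ∀ ws → ∑ F (map rewire ws) (transmitted F (value F (proj₂ K)))
                          R.≈ substitute (∑ F ws (transmitted F (value F H)))
      sum-rewire []             = R.refl
      sum-rewire ((a , j) ∷ ws) = R.+-cong (R.*-congˡ (Computed.correct (ys j))) (sum-rewire ws)

      prod-rewire : ∀ ws → ∏ F (map rewire ws) (transmitted F (value F (proj₂ K)))
                           R.≈ substitute (∏ F ws (transmitted F (value F H)))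
      prod-rewire []             = R.refl
      prod-rewire ((a , j) ∷ ws) = R.*-cong (R.*-congˡ (Computed.correct (ys j))) (prod-rewire ws)

      embedVertex : (∀ x → Computed K (ρ x)) → (v : Vertex F U l) →
                    Extension K (fanIn F v) (λ L → Computed L (substitute (vertexValue F (value F H) v)))
      embedVertex xs (constant a)            = vertex (constant a) R.refl
      -- No vertex is added: the image of the variable has been computed already.
      embedVertex xs (variable′ x)           = return (xs x)
      embedVertex xs (sum-gate (w ∷ ws))     = weaken (ℕ.≤-reflexive (≡.cong suc (length-map rewire ws)))
        (vertex (sum-gate (rewire w ∷ map rewire ws)) (sum-rewire (w ∷ ws)))
      embedVertex xs (product-gate (w ∷ ws)) = weaken (ℕ.≤-reflexive (≡.cong suc (length-map rewire ws)))
        (vertex (product-gate (rewire w ∷ map rewire ws)) (prod-rewire (w ∷ ws)))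

    -- Gates of `H` are copied with their wires redirected to the vertices standing for their
    -- predecessors, so only the wires of `H` are paid for.
    embed : ∀ {l G} (H : DAG F U l) → (∀ x → Computed G (ρ x)) →
            Extension G (wires F H) (λ K → ∀ j → Computed K (substitute (value F H j)))
    embed []      xs = return (λ ())
    embed (H ▷ v) xs = embed H xs >>= λ {K} G⊑K ys →
      embedVertex H K ys (λ x → G⊑K (xs x)) v <&> λ K⊑L y →
      λ { zero → y ; (suc j) → K⊑L (ys j) }

-- Circuits for the partition tensors and for the permanent

splitMode : ∀ {d} (ns ms : Vec ℕ d) e → Fin (lookup (zipWith _*_ ns ms) e) →
            Fin (lookup ns e) × Fin (lookup ms e)
splitMode (n ∷ _)  (m ∷ _)  zero    k = remQuot {n} m k
splitMode (_ ∷ ns) (_ ∷ ms) (suc e) k = splitMode ns ms e k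

-- A substitution is defined on single variables, so indices must be split in one mode without
-- reference to the others.
lookup-splitIndex : ∀ {d} (ns ms : Vec ℕ d) ks e →
  let is , js = splitIndex ns ms ks in (lookup⁺ is e , lookup⁺ js e) ≡ splitMode ns ms e (lookup⁺ ks e)
lookup-splitIndex (_ ∷ _)  (_ ∷ _)  (_ ∷ _)  zero    = ≡.refl
lookup-splitIndex (_ ∷ ns) (_ ∷ ms) (_ ∷ ks) (suc e) = lookup-splitIndex ns ms ks e

module _ {c ℓ₁ ℓ₂} (F : HeytingField c ℓ₁ ℓ₂) where
  private
    module F = HeytingField F

  fieldRing : CommutativeRing c ℓ₁
  fieldRing = HeytingCommutativeRing.commutativeRing F.heytingCommutativeRing

  conHom : (V : Set) → RingHom fieldRing (polyRing F V)
  conHom V = record { ⟦_⟧ = con ; ⟦⟧-cong = con-cong ; +-homo = con-+ ; *-homo = con-*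
                    ; 0-homo = ≈-refl ; 1-homo = ≈-refl }

  -- Inputs have no incoming wires and hence cost nothing.
  variables : ∀ {V n G} (v : Fin n → V) →
              let open Computation F V in Extension G 0 (λ H → ∀ i → Computed H (var (v i)))
  variables {V} {n} v = weaken (ℕ.≤-reflexive (ℕ.*-zeroʳ n))
    (forAll (λ _ H⊑K → H⊑K) (λ i _ → vertex (variable′ (v i)) ≈-refl))
    where open Computation F V

  variables₂ : ∀ {V n G} {l : Fin n → ℕ} (v : ∀ i → Fin (l i) → V) →
               let open Computation F V in Extension G 0 (λ H → ∀ i j → Computed H (var (v i j)))
  variables₂ {V} {n} v = weaken (ℕ.≤-reflexive (ℕ.*-zeroʳ n))
    (forAll (λ _ H⊑K xs j → H⊑K (xs j)) (λ i _ → variables (v i)))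
    where open Computation F V

  module PartitionTensor (m b d : ℕ) (mode : Fin m → Fin m → Fin d) where
    open Arrangement m b d mode

    partitionTensor : Tensor F d
    partitionTensor = record
      { sizes    = modeSizes
      ; nonEmpty = lookup⁻ (λ e → ≡.subst NonZero (≡.sym (lookup-replicate e (2 ^ b))) (ℕ.m^n≢0 2 b))
      ; coeff    = partitioned fieldRing
      }

    open Tensor partitionTensor using (Var; poly)
    open Computation F Var
    private
      R = polyRing F Var
      module R where
        open CommutativeRing R public
        open Sums R public
        open Products R public
      module S = SquareFreeElements b R
      module T = TowerElements m b R

    modeVariable : ∀ e → Fin (2 ^ b) → R.Carrier
    modeVariable e a = var (e , ≡.subst Fin (≡.sym (lookup-replicate e (2 ^ b))) a)

    rowProduct : Fin m → R.Carrier
    rowProduct i = S.top (S.prod (λ j → polynomial R b (modeVariable (mode i j))))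

    module _
      (row : Fin d → Fin m)
      (row-mode : ∀ i j → row (mode i j) ≡ i)
      (reorder : ∀ (f : Fin d → T.Carrier) → T.prod f T.≈ T.prod (λ i → T.prod (λ j → f (mode i j))))
      where

      -- This is `sum-partitioned` with the tensor's own variables as values, that is, with generic
      -- square-free polynomials.
      poly-rowProduct : R.prod rowProduct R.≈ poly
      poly-rowProduct = begin
        R.prod rowProduct
          ≈⟨ sum-partitioned (conHom Var) row row-mode reorder modeVariable ⟨
        R.sumₗ (indices modeSizes) (λ is → con (partitioned fieldRing is) R.* R.prod (λ e → modeVariable e (is ! e)))
          ≈⟨ R.sumₗ-cong (indices modeSizes) (λ is → R.*-congˡ (R.trans
               (R.prod-cong {d} (λ e → R.reflexive (≡.cong (λ i → var (e , i))
                 (≡.subst-sym-subst (lookup-replicate e (2 ^ b))))))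
               (R.sym (R.prodₗ-allFin d _)))) ⟩
        poly ∎
        where open Relation.Binary.Reasoning.Setoid R.setoid

      computePoly : Extension (0 , []) (m * (m * multiplicationCost b) + m * 2) (λ H → Computed H poly)
      computePoly =
        constants >>= λ _ (z , o) →
        variables₂ {n = d} _,_ >>= λ H⊑K xs →
        forAll (λ _ K⊑L → K⊑L) (λ i K⊑L →
          computedS-prod b (K⊑L (H⊑K z)) (K⊑L (H⊑K o))
            (λ j → Coefficients-polynomial b {h = modeVariable (mode i j)} (λ a → K⊑L (xs (mode i j) _))) <&>
          λ _ y → Coefficients-top b _ y) >>= λ K⊑L ys →
        -- `SquareFree 0 R` is `R`, so this is the ordinary product of the m row factors, at two
        -- wires each.
        computedS-prod 0 {u = rowProduct} (K⊑L (H⊑K z)) (K⊑L (H⊑K o)) ys <&> λ _ → computed-resp poly-rowProduct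

  per≈permanent : ∀ n → _≈ₚ_ F (per F n) (permanent (polyRing F (Fin n × Fin n)) (λ i j → var (i , j)))
  per≈permanent n = sumₗ-cong (permutations n) (λ π → prodₗ-allFin n _)
    where
    open Sums (polyRing F (Fin n × Fin n))
    open Products (polyRing F (Fin n × Fin n))

  module _ (m b n k : ℕ) (eq : m * b ≡ n + k) where
    open Grid m b
    private
      V = Fin n × Fin n
      R = polyRing F V
      module R where
        open CommutativeRing R public
        open Sums R public
        open Products R public
      module P = PartitionTensor m b (m ^ 2) mode
      module Q = PartitionTensor m b (m ^ 2) (flip mode)
    open Computation F V

    X : Fin n → Fin n → R.Carrier
    X i j = var (i , j)

    rowTensor columnTensor productTensor : Tensor F (m ^ 2)
    rowTensor     = P.partitionTensor
    columnTensor  = Q.partitionTensor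
    productTensor = _⊗_ F rowTensor columnTensor
    open Tensor productTensor using (Var; poly)

    private
      B = SquareFree b R
      W = blockPermanents m b n k eq R X

    -- The permanent of the submatrix of block (`row e` , `column e`) with row set α and column set
    -- β: outer variables belong to rows, inner ones to columns.
    minors : Fin (m ^ 2) → Fin (2 ^ b) → Fin (2 ^ b) → R.Carrier
    minors e α β = coefficient R b (coefficient B b (W (row e) (column e)) α) β

    assignment : Var → R.Carrier
    assignment (e , l) = let i , j = splitMode modeSizes modeSizes e l in minors e (component e i) (component e j)

    open Substitution assignment

    substitute-∑ : ∀ {x} {A : Set x} (xs : List A) f → substitute (∑ F xs f) ≡ R.sumₗ xs (substitute ∘ f)
    substitute-∑ []       f = ≡.refl
    substitute-∑ (x ∷ xs) f = ≡.cong (substitute (f x) R.+_) (substitute-∑ xs f)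

    substitute-∏ : ∀ {x} {A : Set x} (xs : List A) f → substitute (∏ F xs f) ≡ R.prodₗ xs (substitute ∘ f)
    substitute-∏ []       f = ≡.refl
    substitute-∏ (x ∷ xs) f = ≡.cong (substitute (f x) R.*_) (substitute-∏ xs f)

    -- Splitting each index of the Kronecker product gives a family of row sets and a family of
    -- column sets. Their double sum is a top coefficient by `sum-rows-columns`, and that
    -- coefficient is the permanent by `top-blockPermanents`.
    substitute-poly : substitute poly R.≈ per F n
    substitute-poly = begin
      substitute poly
        ≡⟨ substitute-∑ (indices sizes²) _ ⟩
      R.sumₗ (indices sizes²) (λ ks → con (Tensor.coeff productTensor ks) R.*
        substitute (∏ F (allFin (m ^ 2)) (λ e → var (e , lookup⁺ ks e))))
        ≈⟨ R.sumₗ-cong (indices sizes²) (λ ks → R.*-congˡ (R.trans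
             (R.reflexive (substitute-∏ (allFin (m ^ 2)) _)) (R.trans (R.prodₗ-allFin (m ^ 2) _)
             (R.prod-cong {m ^ 2} (λ e → R.reflexive (≡.cong (λ (i , j) → minors e (component e i) (component e j))
               (≡.sym (lookup-splitIndex modeSizes modeSizes ks e)))))))) ⟩
      R.sumₗ (indices sizes²) (λ ks → term (proj₁ (splitIndex modeSizes modeSizes ks)) (proj₂ (splitIndex modeSizes modeSizes ks)))
        ≈⟨ sumₗ-splitIndex R.+-commutativeMonoid modeSizes modeSizes term ⟩
      R.sumₗ (indices modeSizes) (λ is → R.sumₗ (indices modeSizes) (term is))
        ≈⟨ sum-rows-columns (conHom V) W ⟩
      _ ≈⟨ top-blockPermanents m b n k eq R X ⟩
      permanent R X
        ≈⟨ per≈permanent n ⟨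
      per F n ∎
      where
      open Relation.Binary.Reasoning.Setoid R.setoid
      sizes² = zipWith _*_ modeSizes modeSizes
      term : Index modeSizes → Index modeSizes → R.Carrier
      term is js = con (Rows.partitioned fieldRing is F.* Columns.partitioned fieldRing js) R.*
                   R.prod (λ e → minors e (is ! e) (js ! e))

    -- Each entry is a variable, 0 or 1, so padding adds no wires.
    computed-padded : ∀ {G} → Computed G R.0# → Computed G R.1# → (∀ i j → Computed G (X i j)) →
                      ∀ v w → Computed G (padded R n k eq X v w)
    computed-padded {G} z o x v w = block (splitAt n (≡.subst Fin eq v)) (splitAt n (≡.subst Fin eq w))
      where
      identity : ∀ {k} (i j : Fin k) → Computed G (identityMatrix R i j)
      identity zero    zero    = o
      identity zero    (suc _) = z
      identity (suc _) zero    = z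
      identity (suc i) (suc j) = identity i j
      block : ∀ {k} (i j : Fin n ⊎ Fin k) → Computed G (blockMatrix R X i j)
      block (inj₁ i) (inj₁ j) = x i j
      block (inj₁ _) (inj₂ _) = z
      block (inj₂ _) (inj₁ _) = z
      block (inj₂ i) (inj₂ j) = identity i j

    -- All submatrix permanents of the m * m blocks are computed first; a circuit for the Kronecker
    -- product is then run on them.
    computePer : ∀ {w} → HasCircuitOfSize F poly w →
      Extension (0 , []) (m * (m * (2 ^ b * multiplicationCost b)) + w) (λ H → Computed H (per F n))
    computePer (A , computes , ≡.refl) =
      constants >>= λ _ (z , o) →
      variables₂ {n = n} _,_ >>= λ H⊑K xs →
      let entries = computed-padded (H⊑K z) (H⊑K o) xs in
      forAll (λ i L⊑M ys j → computedSS-mono b b {W i j} L⊑M (ys j)) (λ i K⊑L →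
        forAll (λ j → computedSS-mono b b {W i j}) (λ j L⊑M →
          computedSS-exp b b (L⊑M (K⊑L (H⊑K z))) (L⊑M (K⊑L (H⊑K o))) (λ t →
            computedS-mono b (L⊑M ∘ K⊑L)
              (Coefficients-linear b (H⊑K z) (λ s → entries (combine i t) (combine j s)))))) >>= λ _ ys →
      embed (Circuit.graph A) (λ (e , l) →
        Coefficients-lookup b _ (Coefficients-lookup b _ (ys (row e) (column e)) _) _) <&> λ _ values →
      computed-resp (R.trans (substitute-cong computes) substitute-poly) (values (Circuit.output A))

-- Size estimates

^-distribʳ-* : ∀ k m n → (m * n) ^ k ≡ m ^ k * n ^ k
^-distribʳ-* zero    m n = ≡.refl
^-distribʳ-* (suc k) m n = ≡.trans (≡.cong (m * n *_) (^-distribʳ-* k m n))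
  (solve 4 (λ m n x y → m :* n :* (x :* y) := m :* x :* (n :* y)) ≡.refl m n (m ^ k) (n ^ k))

-- Factors of 4 ^ b for one partition tensor and of 16 ^ b for the permanent. In `sizeConstant` the
-- first summand pays for the submatrix permanents, the second for the Kronecker product.
tensorConstant sizeConstant : ℕ → ℕ
tensorConstant m = 2 * m * m + 2 * m
sizeConstant   m = 2 * m * m + tensorConstant m * tensorConstant m

module _ {c ℓ₁ ℓ₂} (F : HeytingField c ℓ₁ ℓ₂) (m : ℕ)
         (C : Tensor F (m ^ 2) → ℕ) (minimal : IsCircuitComplexity F C) (submult : IsSubmultiplicative F C) where

  module _ (b : ℕ) where
    open Grid m b
    private
      module P = PartitionTensor F m b (m ^ 2) mode
      module Q = PartitionTensor F m b (m ^ 2) (flip mode)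
    open ℕ.≤-Reasoning

    tensor-bound : m * (m * (2 * 4 ^ b)) + m * 2 ≤ tensorConstant m * 4 ^ b
    tensor-bound = begin
      m * (m * (2 * 4 ^ b)) + m * 2
        ≤⟨ ℕ.+-monoʳ-≤ _ (ℕ.*-monoʳ-≤ m (ℕ.*-monoʳ-≤ 2 (ℕ.m^n>0 4 b))) ⟩
      m * (m * (2 * 4 ^ b)) + m * (2 * 4 ^ b)
        ≡⟨ solve 2 (λ m x → m :* (m :* (lit 2 :* x)) :+ m :* (lit 2 :* x)
                            := (lit 2 :* m :* m :+ lit 2 :* m) :* x) ≡.refl m (4 ^ b) ⟩
      tensorConstant m * 4 ^ b ∎

    complexity≤ : ∀ {T w} → let open Computation F (Tensor.Var T) in
                  Extension (0 , []) w (λ H → Computed H (Tensor.poly T)) → C T ≤ w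
    complexity≤ {T} E with Computation.circuit F (Tensor.Var T) E
    ... | t , t≤w , A = ℕ.≤-trans (proj₂ (minimal T) t A) t≤w

    4*4≡16 : 4 ^ b * 4 ^ b ≡ 16 ^ b
    4*4≡16 = ≡.sym (^-distribʳ-* b 4 4)

    -- Submultiplicativity enters here: two bounds of order 4 ^ b multiply to one of order 16 ^ b.
    product-bound : C (_⊗_ F P.partitionTensor Q.partitionTensor) ≤ tensorConstant m * tensorConstant m * 16 ^ b
    product-bound = begin
      C (_⊗_ F P.partitionTensor Q.partitionTensor)
        ≤⟨ submult P.partitionTensor Q.partitionTensor ⟩
      C P.partitionTensor * C Q.partitionTensor
        ≤⟨ ℕ.*-mono-≤
             (ℕ.≤-trans (complexity≤ (P.computePoly row row-mode (by-rows (CommutativeRing.*-commutativeMonoid (Tower m b (polyRing F _)))))) tensor-bound)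
             (ℕ.≤-trans (complexity≤ (Q.computePoly column (flip column-mode) (by-columns (CommutativeRing.*-commutativeMonoid (Tower m b (polyRing F _)))))) tensor-bound) ⟩
      (tensorConstant m * 4 ^ b) * (tensorConstant m * 4 ^ b)
        ≡⟨ solve 2 (λ k x → (k :* x) :* (k :* x) := k :* k :* (x :* x)) ≡.refl (tensorConstant m) (4 ^ b) ⟩
      tensorConstant m * tensorConstant m * (4 ^ b * 4 ^ b)
        ≡⟨ ≡.cong (tensorConstant m * tensorConstant m *_) 4*4≡16 ⟩
      tensorConstant m * tensorConstant m * 16 ^ b ∎

    per-circuit : ∀ n k → m * b ≡ n + k → ∃[ t ] t ≤ sizeConstant m * 16 ^ b × HasCircuitOfSize F (per F n) t
    per-circuit n k eq with Computation.circuit F (Fin n × Fin n)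
      (computePer F m b n k eq (proj₁ (minimal (_⊗_ F P.partitionTensor Q.partitionTensor))))
    ... | t , t≤ , A = t , ℕ.≤-trans t≤ bound , A
      where
      bound : m * (m * (2 ^ b * (2 * 4 ^ b))) + C (_⊗_ F P.partitionTensor Q.partitionTensor) ≤ sizeConstant m * 16 ^ b
      bound = begin
        m * (m * (2 ^ b * (2 * 4 ^ b))) + C (_⊗_ F P.partitionTensor Q.partitionTensor)
          -- The submatrix permanents cost 2 ^ b * 4 ^ b up to a constant; replacing 2 ^ b by 4 ^ b
          -- gives the common order 16 ^ b.
          ≤⟨ ℕ.+-mono-≤ (ℕ.*-monoʳ-≤ m (ℕ.*-monoʳ-≤ m (ℕ.*-monoˡ-≤ (2 * 4 ^ b) (ℕ.^-monoˡ-≤ b (s≤s (s≤s (z≤n {2}))))))) product-bound ⟩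
        m * (m * (4 ^ b * (2 * 4 ^ b))) + tensorConstant m * tensorConstant m * 16 ^ b
          ≡⟨ ≡.cong (_+ tensorConstant m * tensorConstant m * 16 ^ b)
               (solve 2 (λ m x → m :* (m :* (x :* (lit 2 :* x))) := lit 2 :* m :* m :* (x :* x)) ≡.refl m (4 ^ b)) ⟩
        2 * m * m * (4 ^ b * 4 ^ b) + tensorConstant m * tensorConstant m * 16 ^ b
          ≡⟨ ≡.cong (λ x → 2 * m * m * x + tensorConstant m * tensorConstant m * 16 ^ b) 4*4≡16 ⟩
        2 * m * m * 16 ^ b + tensorConstant m * tensorConstant m * 16 ^ b
          ≡⟨ ℕ.*-distribʳ-+ (16 ^ b) (2 * m * m) _ ⟨
        sizeConstant m * 16 ^ b ∎

ceiling-bound : ∀ {a m x} → a ≤ m ·ℝ x → ∀ p q .{{_ : NonZero q}} → x ℝ< (+ p ℚ./ q) → a * q ≤ m * p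
ceiling-bound {a} {m} a≤mx p q@(suc q-1) x<p/q = ℤ.drop‿+≤+ (≡.subst₂ ℤ._≤_ lhs rhs (ℚᵘ.drop-*≤* a≤mp/q))
  where
  open ℚᵘ.≤-Reasoning
  -- Unnormalised rationals avoid reduction to lowest terms, so clearing denominators yields the
  -- integer inequality directly.
  a≤mp/q : mkℚᵘ (+ a) 0 ℚᵘ.≤ mkℚᵘ (+ m) 0 ℚᵘ.* mkℚᵘ (+ p) q-1
  a≤mp/q = begin
    mkℚᵘ (+ a) 0                              ≃⟨ ℚ.toℚᵘ-fromℚᵘ (mkℚᵘ (+ a) 0) ⟨
    toℚᵘ (+ a ℚ./ 1)                        ≤⟨ ℚ.toℚᵘ-mono-≤ (a≤mx (+ p ℚ./ q) x<p/q) ⟩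
    toℚᵘ ((+ m ℚ./ 1) ℚ.* (+ p ℚ./ q))      ≃⟨ ℚ.toℚᵘ-homo-* (+ m ℚ./ 1) (+ p ℚ./ q) ⟩
    toℚᵘ (+ m ℚ./ 1) ℚᵘ.* toℚᵘ (+ p ℚ./ q)
      ≃⟨ ℚᵘ.*-cong (ℚ.toℚᵘ-fromℚᵘ (mkℚᵘ (+ m) 0)) (ℚ.toℚᵘ-fromℚᵘ (mkℚᵘ (+ p) q-1)) ⟩
    mkℚᵘ (+ m) 0 ℚᵘ.* mkℚᵘ (+ p) q-1          ∎
  lhs : + a ℤ.* + (1 * q) ≡ + (a * q)
  lhs = ≡.trans (≡.sym (ℤ.pos-* a (1 * q))) (≡.cong (λ q → + (a * q)) (ℕ.*-identityˡ q))
  rhs : (+ m ℤ.* + p) ℤ.* + 1 ≡ + (m * p)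
  rhs = ≡.trans (ℤ.*-identityʳ _) (≡.sym (ℤ.pos-* m p))

-- With x = n / m rounded down, 4 q ≤ m p gives 4 x q ≤ p (x m) ≤ p n. The extra factor 16, from
-- rounding the block side up, joins the constant.
exponent-bound : ∀ K m .{{_ : NonZero m}} n p q {s} → 4 * q ≤ m * p → s ≤ K * 16 ^ suc (n / m) →
                 s ^ q ≤ (K * 16) ^ q * 2 ^ (p * n)
exponent-bound K m n p q {s} 4q≤mp s≤ = begin
  s ^ q                              ≤⟨ ℕ.^-monoˡ-≤ q s≤ ⟩
  (K * (16 * 16 ^ x)) ^ q            ≡⟨ ≡.cong (_^ q) (≡.sym (ℕ.*-assoc K 16 (16 ^ x))) ⟩
  (K * 16 * 16 ^ x) ^ q              ≡⟨ ^-distribʳ-* q (K * 16) (16 ^ x) ⟩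
  -- Here 16 is read as 2 ^ 4.
  (K * 16) ^ q * (16 ^ x) ^ q        ≡⟨ ≡.cong (λ y → (K * 16) ^ q * y ^ q) (ℕ.^-*-assoc 2 4 x) ⟩
  (K * 16) ^ q * (2 ^ (4 * x)) ^ q   ≡⟨ ≡.cong ((K * 16) ^ q *_) (ℕ.^-*-assoc 2 (4 * x) q) ⟩
  (K * 16) ^ q * 2 ^ (4 * x * q)     ≤⟨ ℕ.*-monoʳ-≤ ((K * 16) ^ q) (ℕ.^-monoʳ-≤ 2 exponent) ⟩
  (K * 16) ^ q * 2 ^ (p * n)         ∎
  where
  open ℕ.≤-Reasoning
  x = n / m
  exponent : 4 * x * q ≤ p * n
  exponent = begin
    4 * x * q    ≡⟨ solve 2 (λ x q → lit 4 :* x :* q := lit 4 :* q :* x) ≡.refl x q ⟩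
    4 * q * x    ≤⟨ ℕ.*-monoˡ-≤ x 4q≤mp ⟩
    m * p * x    ≡⟨ solve 3 (λ m p x → m :* p :* x := p :* (x :* m)) ≡.refl m p x ⟩
    p * (x * m)  ≤⟨ ℕ.*-monoʳ-≤ p (m/n*n≤m n m) ⟩
    p * n        ∎

n≤m*suc[n/m] : ∀ n m .{{_ : NonZero m}} → n ≤ m * suc (n / m)
n≤m*suc[n/m] n m = begin
  n                    ≡⟨ m≡m%n+[m/n]*n n m ⟩
  n % m + n / m * m    ≤⟨ ℕ.+-monoˡ-≤ _ (ℕ.<⇒≤ (m%n<n n m)) ⟩
  m + n / m * m        ≡⟨ ℕ.*-comm (suc (n / m)) m ⟩
  m * suc (n / m)      ∎
  where open ℕ.≤-Reasoning

theorem3 : ∀ {a ℓ₁ ℓ₂} (F : HeytingField a ℓ₁ ℓ₂) →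
    ∀ (c : ℝ) → 0ℚ <ℝ c → c ℝ< 1ℚ →
    ∀ (m : ℕ) → m Is⌈ 4 / c ⌉ →
    ∀ (C : Tensor F (m ^ 2) → ℕ) → IsCircuitComplexity F C →
    IsSubmultiplicative F C →
    ∃[ s ] (∀ n → HasCircuitOfSize F (per F n) (s n)) × s ∈O[2^ c ·n]
-- With m = 0, the upper bound 1 / 1 for c would give 4 ≤ 0.
theorem3 F c _ c<1 zero (4≤0 , _) C minimal submult with ceiling-bound {4} {0} {c} 4≤0 1 1 c<1
... | ()
theorem3 F c _ _ m@(suc _) (4≤mc , _) C minimal submult =
  -- The constant is K * 16 and the threshold is 0, as the bound holds for every n.
  proj₁ ∘ circuits , (λ n → proj₂ (proj₂ (circuits n))) , K * 16 , 0 ,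
  λ n _ p q c<p/q → exponent-bound K m n p q
    (ceiling-bound {4} {m} {c} 4≤mc p q c<p/q) (proj₁ (proj₂ (circuits n)))
  where
  K = sizeConstant m
  circuits : ∀ n → ∃[ t ] t ≤ K * 16 ^ suc (n / m) × HasCircuitOfSize F (per F n) t
  -- The block side is n / m + 1, and the difference of m times this side and n is the size of the
  -- identity block.
  circuits n = per-circuit F m C minimal submult (suc (n / m)) n (m * suc (n / m) ∸ n)
    (≡.sym (ℕ.m+[n∸m]≡n (n≤m*suc[n/m] n m)))
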